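{- There exists an effective programming system (eps) $\psi$ satisfying both (a) and (b) below. (a) $\psi$ is minimal. (b) For each computably enumerable equivalence relation (ceer) $R$, there exists a translation function $t$ into $\psi$ such that $R$ does not weakly tie $t$ into $\psi$.
   Context: $\mathbb{N}=\{0,1,2,\dots\}$. Partial functions map $\mathbb{N}$ to $\mathbb{N}$ unless stated otherwise; equality of partial functions means same domain and same values. An effective programming system (eps) is a partial computable function $\psi:(p,x)\mapsto\psi_p(x)$ from $\mathbb{N}^2$ to $\mathbb{N}$ such that for each partial computable function $\zeta$ from $\mathbb{N}$ to $\mathbb{N}$ there exists $p$ with $\psi_p=\zeta$. Here $\psi_p$ denotes the partial function $x\mapsto\psi_p(x)$. For epses $\theta$ and $\psi$, $\theta\le\psi$ iff there exists a (total) computable function $t:\mathbb{N}\to\mathbb{N}$ such that $\theta_p=\psi_{t(p)}$ for each $p$; such a $t$ is said to witness $\theta\le\psi$. An eps $\psi$ is minimal iff, for each eps $\theta$, $\theta\le\psi$ implies $\psi\le\theta$. A function $t:\mathbb{N}\to\mathbb{N}$ is a translation function into an eps $\psi$ iff there exists an eps $\theta$ such that $t$ witnesses $\theta\le\psi$ (equivalently, $t$ is computable and $(p,x)\mapsto\psi_{t(p)}(x)$ is an eps). The program equivalence relation of an eps $\psi$ is $\mathrm{Equiv}(\psi)=\{(p,q)\in\mathbb{N}^2 : \psi_p=\psi_q\}$. A ceer is an equivalence relation on $\mathbb{N}$ that is computably enumerable as a set of pairs. Let $\psi$ be an eps, $t$ a translation function into $\psi$, and $R$ an equivalence relation on $\mathbb{N}$.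 $R$ weakly ties $t$ into $\psi$ iff (i) $R\subseteq\mathrm{Equiv}(\psi)$ and (ii*) the range of $t$ intersects all but finitely many of $R$'s equivalence classes. -}

module Defs where

open import Level using (0ℓ)
open import Data.Fin.Base using (Fin)
open import Data.List.Relation.Unary.Any using (Any)
open import Data.Nat.Base as ℕ using (ℕ; _<_)
open import Data.Nat.Properties using (<-cmp; 0≢1+n)
open import Data.Product.Base using (∃; ∃-syntax; _×_; _,_)
open import Data.Vec.Base using (Vec; []; _∷_; head; lookup)
open import Data.Vec.Relation.Binary.Pointwise.Inductive using (Pointwise; []; _∷_)
open import Function.Bundles using (_⇔_)
open import Relation.Binary.Core using (Rel; _⇒_)
open import Relation.Binary.Definitions using (tri<; tri≈; tri>)
open import Relation.Binary.PropositionalEquality using (_≡_; refl; sym; trans)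
open import Relation.Binary.Structures using (IsEquivalence)
open import Relation.Nullary using (¬_; contradiction)
open import Relation.Unary using (Pred; _≬_)

-- Partial functions are single-valued relations rather than Agda functions, so
-- that neither totality nor decidability of the domain is built in.

infix 3 _⇀_ _≗_

record _⇀_ (A B : Set) : Set₁ where
  field
    graph         : A → B → Set
    deterministic : ∀ {x y z} → graph x y → graph x z → y ≡ z

open _⇀_ public

dom : ∀ {A B} → A ⇀ B → Pred A 0ℓ
dom f x = ∃[ y ] graph f x y

-- Same graph, hence same domain and same values.

_≗_ : ∀ {A B} → A ⇀ B → A ⇀ B → Set
f ≗ g = ∀ x y → graph f x y ⇔ graph g x y

total : (ℕ → ℕ) → Vec ℕ 1 ⇀ ℕ
total t = record
  { graph         = λ xs y → t (head xs) ≡ y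
  ; deterministic = λ e e′ → trans (sym e) e′
  }

-- Kleene's μ-recursive functions.  `rec f g` recurses on its first argument,
-- and `g` receives the predecessor, then the previous value, then the
-- parameters.  `zero` is nullary: `comp zero []` is 0 at any arity.

data Code : ℕ → Set where
  zero : Code 0
  succ : Code 1
  proj : ∀ {n} → Fin n → Code n
  comp : ∀ {m n} → Code m → Vec (Code n) m → Code n
  rec  : ∀ {n} → Code n → Code (2 ℕ.+ n) → Code (1 ℕ.+ n)
  mu   : ∀ {n} → Code (1 ℕ.+ n) → Code n

infix 4 _[_]⇓_

data _[_]⇓_ : ∀ {n} → Code n → Vec ℕ n → ℕ → Set where
  ⇓-zero : zero [ [] ]⇓ 0
  ⇓-succ : ∀ {x} → succ [ x ∷ [] ]⇓ ℕ.suc x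
  ⇓-proj : ∀ {n} {i : Fin n} {xs} → proj i [ xs ]⇓ lookup xs i
  ⇓-comp : ∀ {m n} {f : Code m} {gs : Vec (Code n) m} {xs ys z} →
           Pointwise (λ g y → g [ xs ]⇓ y) gs ys →
           f [ ys ]⇓ z →
           comp f gs [ xs ]⇓ z
  ⇓-rec₀ : ∀ {n} {f : Code n} {g xs y} →
           f [ xs ]⇓ y →
           rec f g [ 0 ∷ xs ]⇓ y
  ⇓-rec₊ : ∀ {n} {f : Code n} {g xs k r y} →
           rec f g [ k ∷ xs ]⇓ r →
           g [ k ∷ r ∷ xs ]⇓ y →
           rec f g [ ℕ.suc k ∷ xs ]⇓ y
  -- All values below the root are required to be defined and nonzero.
  ⇓-mu   : ∀ {n} {f : Code (1 ℕ.+ n)} {xs y} →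
           (∀ z → z < y → ∃[ k ] f [ z ∷ xs ]⇓ ℕ.suc k) →
           f [ y ∷ xs ]⇓ 0 →
           mu f [ xs ]⇓ y

mutual
  ⇓-deterministic : ∀ {n} (c : Code n) {xs y z} →
                    c [ xs ]⇓ y → c [ xs ]⇓ z → y ≡ z
  ⇓-deterministic zero ⇓-zero ⇓-zero = refl
  ⇓-deterministic succ ⇓-succ ⇓-succ = refl
  ⇓-deterministic (proj i) ⇓-proj ⇓-proj = refl
  ⇓-deterministic (comp f gs) (⇓-comp ds d) (⇓-comp es e)
    with refl ← ⇓*-deterministic gs ds es = ⇓-deterministic f d e
  ⇓-deterministic (rec f g) (⇓-rec₀ d) (⇓-rec₀ e) = ⇓-deterministic f d e
  ⇓-deterministic (rec f g) (⇓-rec₊ d d′) (⇓-rec₊ e e′)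
    with refl ← ⇓-deterministic (rec f g) d e = ⇓-deterministic g d′ e′
  ⇓-deterministic (mu f) {y = y} {z} (⇓-mu below d) (⇓-mu below′ e)
    with <-cmp y z
  ... | tri≈ _ y≡z _ = y≡z
  ... | tri< y<z _ _ with _ , e′ ← below′ y y<z =
        contradiction (⇓-deterministic f d e′) 0≢1+n
  ... | tri> _ _ z<y with _ , d′ ← below z z<y =
        contradiction (⇓-deterministic f e d′) 0≢1+n

  ⇓*-deterministic : ∀ {m n} (gs : Vec (Code n) m) {xs ys zs} →
                     Pointwise (λ g y → g [ xs ]⇓ y) gs ys →
                     Pointwise (λ g y → g [ xs ]⇓ y) gs zs → ys ≡ zs
  ⇓*-deterministic [] [] [] = refl
  ⇓*-deterministic (g ∷ gs) (d ∷ ds) (e ∷ es)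
    with refl ← ⇓-deterministic g d e
       | refl ← ⇓*-deterministic gs ds es = refl

⟦_⟧ : ∀ {n} → Code n → Vec ℕ n ⇀ ℕ
⟦ c ⟧ = record
  { graph         = c [_]⇓_
  ; deterministic = ⇓-deterministic c
  }

PartialComputable : ∀ {n} → Vec ℕ n ⇀ ℕ → Set
PartialComputable f = ∃[ c ] f ≗ ⟦ c ⟧

Computable : (ℕ → ℕ) → Set
Computable t = PartialComputable (total t)

-- `ψ ⟨ p ⟩` is the partial function written ψ_p.

infix 8 _⟨_⟩

_⟨_⟩ : Vec ℕ 2 ⇀ ℕ → ℕ → Vec ℕ 1 ⇀ ℕ
ψ ⟨ p ⟩ = record
  { graph         = λ xs → graph ψ (p ∷ xs)
  ; deterministic = deterministic ψ
  }

record IsEps (ψ : Vec ℕ 2 ⇀ ℕ) : Set₁ where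
  field
    partialComputable : PartialComputable ψ
    universal         : ∀ (ζ : Vec ℕ 1 ⇀ ℕ) → PartialComputable ζ →
                        ∃[ p ] ψ ⟨ p ⟩ ≗ ζ

record Witnesses (t : ℕ → ℕ) (θ ψ : Vec ℕ 2 ⇀ ℕ) : Set where
  field
    computable : Computable t
    translates : ∀ p → θ ⟨ p ⟩ ≗ ψ ⟨ t p ⟩

infix 4 _≤ₑ_

_≤ₑ_ : (θ ψ : Vec ℕ 2 ⇀ ℕ) → Set
θ ≤ₑ ψ = ∃[ t ] Witnesses t θ ψ

Minimal : Vec ℕ 2 ⇀ ℕ → Set₁
Minimal ψ = ∀ θ → IsEps θ → θ ≤ₑ ψ → ψ ≤ₑ θ

IsTranslationInto : (ℕ → ℕ) → Vec ℕ 2 ⇀ ℕ → Set₁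
IsTranslationInto t ψ = ∃[ θ ] IsEps θ × Witnesses t θ ψ

Equiv : Vec ℕ 2 ⇀ ℕ → Rel ℕ 0ℓ
Equiv ψ p q = ψ ⟨ p ⟩ ≗ ψ ⟨ q ⟩

-- A set is computably enumerable iff it is the domain of a partial computable
-- function.

ComputablyEnumerable : Rel ℕ 0ℓ → Set₁
ComputablyEnumerable R =
  ∃[ φ ] PartialComputable φ × (∀ p q → R p q ⇔ dom φ (p ∷ q ∷ []))

record IsCeer (R : Rel ℕ 0ℓ) : Set₁ where
  field
    isEquivalence        : IsEquivalence R
    computablyEnumerable : ComputablyEnumerable R

range : (ℕ → ℕ) → Pred ℕ 0ℓ
range t y = ∃[ n ] t n ≡ y

-- The equivalence class of x is the predicate `R x`.  Finitely many classes
-- are given by a list of representatives.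

MeetsCofinitelyManyClasses : Rel ℕ 0ℓ → Pred ℕ 0ℓ → Set
MeetsCofinitelyManyClasses R A =
  ∃[ ys ] (∀ x → ¬ (A ≬ R x) → Any (R x) ys)

record WeaklyTies (R : Rel ℕ 0ℓ) (t : ℕ → ℕ) (ψ : Vec ℕ 2 ⇀ ℕ) : Set where
  field
    within   : R ⇒ Equiv ψ
    cofinite : MeetsCofinitelyManyClasses R (range t)

-- The eps ψ consists of pairs of programs a_m, b_m, one for each m = ⟨e, k⟩, of
-- frozen programs, whose finite graphs are known and have odd size, and of
-- Friedberg-style candidates for the remaining functions, each of which has
-- exactly one candidate that is never frozen.  Hence apart from equalities
-- a_m = b_m, all equalities between programs are detected computably.
--
-- The programs of the pair m differ as long as some program f < e has not yet
-- hit both of them, f working on one pair at a time.  So if f computes a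
-- translation function, then it hits both programs of every pair with e > f;
-- for e ≤ f only finitely many pairs remain split, since each f and each e
-- splits at most one of them for good.  This makes ψ minimal.
--
-- If the ceer R with index e ever relates a_m and b_m for some m = ⟨e, k⟩, then
-- one such pair is split for good, and R is not contained in Equiv(ψ).
-- Otherwise the translation function merging b_m into a_m for the pairs
-- m = ⟨e, k⟩ that are not split misses infinitely many classes of R.

module Submission where

open import Defs
open import Level using (0ℓ)
open import Axiom.ExcludedMiddle using (ExcludedMiddle)
open import Data.Fin.Base using (Fin; zero; suc)
open import Data.Fin.Patterns
open import Data.List.Base using (List; []; _∷_)
open import Data.List.Relation.Unary.Any using (Any; here; there)
open import Data.Nat.Base
  using (ℕ; suc; pred; _+_; _*_; _∸_; _⊔_; _≤_; _<_; z≤n; s≤s; z<s; s<s; s≤s⁻¹)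
open import Data.Nat.Properties
open import Data.Product.Base using (Σ; ∃; ∃-syntax; _×_; _,_; proj₁; proj₂)
open import Data.Sum.Base using (_⊎_; inj₁; inj₂; [_,_]′)
open import Data.Vec.Base as Vec using (Vec; []; _∷_; lookup; tabulate)
open import Data.Vec.Properties using (tabulate∘lookup)
open import Data.Vec.Relation.Binary.Pointwise.Inductive using (Pointwise; []; _∷_)
open import Function.Base using (_∘_)
open import Function.Bundles using (_⇔_; mk⇔; Equivalence)
open import Relation.Binary.Core using (Rel)
open import Relation.Binary.Definitions using (tri<; tri≈; tri>)
open import Relation.Binary.PropositionalEquality
  using (_≡_; _≢_; refl; sym; trans; cong; cong₂; subst; subst₂)
open import Relation.Binary.Structures using (module IsEquivalence)
open import Relation.Nullary using (¬_; Dec; yes; no; contradiction)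

-- Total computable functions and decidable predicates

-- A translation function is inverted by searching for an image that is visibly equal to the given
-- program. Minimality thus needs enough equalities to be enumerable, while (b) needs every ceer to
-- miss some. Both are possible because the enumeration may depend on f: for e > f both programs are
-- images themselves, so nothing has to be recognised, and for e ≤ f equality is simply declared, at
-- the price of finitely many errors that a finite table repairs. Exempting f from the pairs with e
-- ≤ f leaves almost all pairs with a given e unsplit.
--
-- Splitting by f is coded by two nested c.e. conditions at one point: f is done with all pairs
-- before m, and f is done with m as well. They differ exactly if f stops at m.
--
-- Parity makes abandoned candidates harmless. They are frozen at unpredictable stages, yet must not
-- equal a function reserved for one candidate or one pair; an odd finite domain is neither that of
-- a pair, which is infinite, nor that of a live candidate, which is infinite or of even size.

open Equivalence using (to; from)

-- The truth value "yes" of a characteristic function is 0, so that conjunction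
-- is a sum and disjunction a product.

record Comp {n} (f : Vec ℕ n → ℕ) : Set where
  constructor _computedBy_
  field
    code     : Code n
    computes : ∀ xs → code [ xs ]⇓ f xs

open Comp

record Rec {n} (P : Vec ℕ n → Set) : Set where
  field
    χ     : Vec ℕ n → ℕ
    χᶜ    : Comp χ
    sound : ∀ xs → χ xs ≡ 0 → P xs
    compl : ∀ xs → P xs → χ xs ≡ 0

open Rec

private variable
  n : ℕ
  a b c d : Vec ℕ n → ℕ
  P Q : Vec ℕ n → Set

dec : Rec P → ∀ xs → Dec (P xs)
dec R xs with χ R xs in eq
... | 0     = yes (sound R xs eq)
... | suc _ = no λ p → 0≢1+n (trans (sym (compl R xs p)) eq)

varᶜ : ∀ i → Comp {n} (λ xs → lookup xs i)
varᶜ i = proj i computedBy λ _ → ⇓-proj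

sucᶜ : Comp a → Comp (λ xs → suc (a xs))
sucᶜ (p computedBy h) = comp succ (p ∷ []) computedBy λ xs → ⇓-comp (h xs ∷ []) ⇓-succ

constᶜ : ∀ k → Comp {n} (λ _ → k)
constᶜ 0       = comp zero [] computedBy λ _ → ⇓-comp [] ⇓-zero
constᶜ (suc k) = sucᶜ (constᶜ k)

at₁ : {f : Vec ℕ 1 → ℕ} → Comp f → Comp a → Comp (λ xs → f (a xs ∷ []))
at₁ (p computedBy h) (q computedBy k) =
  comp p (q ∷ []) computedBy λ xs → ⇓-comp (k xs ∷ []) (h _)

at₂ : {f : Vec ℕ 2 → ℕ} → Comp f → Comp a → Comp b → Comp (λ xs → f (a xs ∷ b xs ∷ []))
at₂ (p computedBy h) (q computedBy k) (r computedBy l) =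
  comp p (q ∷ r ∷ []) computedBy λ xs → ⇓-comp (k xs ∷ l xs ∷ []) (h _)

at₃ : {f : Vec ℕ 3 → ℕ} → Comp f → Comp a → Comp b → Comp c →
      Comp (λ xs → f (a xs ∷ b xs ∷ c xs ∷ []))
at₃ (p computedBy h) (q computedBy k) (r computedBy l) (s computedBy m) =
  comp p (q ∷ r ∷ s ∷ []) computedBy λ xs → ⇓-comp (k xs ∷ l xs ∷ m xs ∷ []) (h _)

at₄ : {f : Vec ℕ 4 → ℕ} → Comp f → Comp a → Comp b → Comp c → Comp d →
      Comp (λ xs → f (a xs ∷ b xs ∷ c xs ∷ d xs ∷ []))
at₄ (p computedBy h) (q computedBy k) (r computedBy l) (s computedBy m) (t computedBy o) =
  comp p (q ∷ r ∷ s ∷ t ∷ []) computedBy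
    λ xs → ⇓-comp (k xs ∷ l xs ∷ m xs ∷ o xs ∷ []) (h _)

-- Computability is proved once on plain variables and then transported by substitution. This spares
-- weakening `a` and `b` under the two extra arguments of a recursion step.
lift₂ : (f : ℕ → ℕ → ℕ) → Comp {2} (λ xs → f (lookup xs 0F) (lookup xs 1F)) →
        Comp a → Comp b → Comp (λ xs → f (a xs) (b xs))
lift₂ f = at₂

lift₃ : (f : ℕ → ℕ → ℕ → ℕ) →
        Comp {3} (λ xs → f (lookup xs 0F) (lookup xs 1F) (lookup xs 2F)) →
        Comp a → Comp b → Comp c → Comp (λ xs → f (a xs) (b xs) (c xs))
lift₃ f = at₃

lift₄ : (f : ℕ → ℕ → ℕ → ℕ → ℕ) →
        Comp {4} (λ xs → f (lookup xs 0F) (lookup xs 1F) (lookup xs 2F) (lookup xs 3F)) →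
        Comp a → Comp b → Comp c → Comp d →
        Comp (λ xs → f (a xs) (b xs) (c xs) (d xs))
lift₄ f = at₄

vars⇓ : ∀ {m} (f : Fin m → Fin n) →
        ∃[ gs ] (∀ xs → Pointwise (λ g y → g [ xs ]⇓ y) {m} gs (tabulate (lookup xs ∘ f)))
vars⇓ {m = 0}     f = [] , λ _ → []
vars⇓ {m = suc m} f with gs , h ← vars⇓ (f ∘ suc) = proj (f zero) ∷ gs , λ xs → ⇓-proj ∷ h xs

letᶜ : {f : Vec ℕ (suc n) → ℕ} → Comp a → Comp f → Comp (λ xs → f (a xs ∷ xs))
letᶜ {n = n} (q computedBy k) (p computedBy h) with gs , l ← vars⇓ {n} (λ i → i) =
  comp p (q ∷ gs) computedBy
    λ xs → ⇓-comp (k xs ∷ subst (Pointwise _ gs) (tabulate∘lookup xs) (l xs)) (h _)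

primRecᶜ : (h : ℕ → Vec ℕ n → ℕ) {g : Vec ℕ (2 + n) → ℕ} → Comp a → Comp b → Comp g →
           (∀ xs → h 0 xs ≡ b xs) → (∀ k xs → h (suc k) xs ≡ g (k ∷ h k xs ∷ xs)) →
           Comp (λ xs → h (a xs) xs)
primRecᶜ h {g} aᶜ (p computedBy base) (q computedBy step) h₀ h₊ =
  letᶜ {f = λ { (k ∷ xs) → h k xs }} aᶜ (rec p q computedBy λ { (k ∷ xs) → go k xs })
  where
  go : ∀ k xs → rec p q [ k ∷ xs ]⇓ h k xs
  go 0       xs rewrite h₀ xs   = ⇓-rec₀ (base xs)
  go (suc k) xs rewrite h₊ k xs = ⇓-rec₊ (go k xs) (step _)

predᶜ : Comp a → Comp (λ xs → pred (a xs))
predᶜ aᶜ = primRecᶜ (λ k _ → pred k) aᶜ (constᶜ 0) (varᶜ 0F) (λ _ → refl) λ _ _ → refl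

+ᶜ : Comp a → Comp b → Comp (λ xs → a xs + b xs)
+ᶜ {b = b} aᶜ bᶜ =
  primRecᶜ (λ k xs → k + b xs) aᶜ bᶜ (sucᶜ (varᶜ 1F)) (λ _ → refl) λ _ _ → refl

∸ᶜ : Comp a → Comp b → Comp (λ xs → a xs ∸ b xs)
∸ᶜ {a = a} aᶜ bᶜ =
  primRecᶜ (λ k xs → a xs ∸ k) bᶜ aᶜ (predᶜ (varᶜ 1F)) (λ _ → refl)
    λ k xs → sym (pred[m∸n]≡m∸[1+n] (a xs) k)

*ᶜ : Comp a → Comp b → Comp (λ xs → a xs * b xs)
*ᶜ = lift₂ _*_ (primRecᶜ (λ k xs → k * lookup xs 1F) (varᶜ 0F) (constᶜ 0)
                  (+ᶜ (varᶜ 3F) (varᶜ 1F)) (λ _ → refl) λ _ _ → refl)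

ifz : ℕ → ℕ → ℕ → ℕ
ifz 0       x y = x
ifz (suc _) x y = y

ifzᶜ : Comp a → Comp b → Comp c → Comp (λ xs → ifz (a xs) (b xs) (c xs))
ifzᶜ {b = b} {c = c} aᶜ bᶜ cᶜ =
  lift₃ ifz (primRecᶜ (λ k xs → ifz k (lookup xs 1F) (lookup xs 2F)) (varᶜ 0F) (varᶜ 1F)
               (varᶜ 4F) (λ _ → refl) λ _ _ → refl) aᶜ bᶜ cᶜ

-- Weakening by the previous value of a recursion; case distinctions are recursions that ignore this
-- value.
skip₁ᶜ : {f : Vec ℕ (suc n) → ℕ} → Comp f → Comp {2 + n} (λ { (k ∷ _ ∷ xs) → f (k ∷ xs) })
skip₁ᶜ {n = n} (p computedBy h) with gs , l ← vars⇓ {2 + n} (λ i → suc (suc i)) =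
  comp p (proj 0F ∷ gs) computedBy λ { (k ∷ r ∷ xs) →
    ⇓-comp (⇓-proj ∷ subst (Pointwise _ gs) (tabulate∘lookup xs) (l (k ∷ r ∷ xs))) (h _) }

caseᶜ : (f : Vec ℕ n → ℕ → ℕ) → Comp a → Comp (λ xs → f xs 0) →
        {g : Vec ℕ (suc n) → ℕ} → Comp g → (∀ k xs → f xs (suc k) ≡ g (k ∷ xs)) →
        Comp (λ xs → f xs (a xs))
caseᶜ f aᶜ zᶜ gᶜ e = primRecᶜ (λ k xs → f xs k) aᶜ zᶜ (skip₁ᶜ gᶜ) (λ _ → refl) e

∑< : (ℕ → ℕ) → ℕ → ℕ
∑< f 0       = 0
∑< f (suc n) = f n + ∑< f n

∑<-zero : ∀ f n → (∀ x → x < n → f x ≡ 0) → ∑< f n ≡ 0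
∑<-zero f 0       h = refl
∑<-zero f (suc n) h rewrite h n ≤-refl = ∑<-zero f n λ x x<n → h x (m<n⇒m<1+n x<n)

∑<-zero⁻¹ : ∀ f n → ∑< f n ≡ 0 → ∀ x → x < n → f x ≡ 0
∑<-zero⁻¹ f (suc n) e x x<1+n with m<1+n⇒m<n∨m≡n x<1+n
... | inj₁ x<n  = ∑<-zero⁻¹ f n (m+n≡0⇒n≡0 (f n) e) x x<n
... | inj₂ refl = m+n≡0⇒m≡0 (f n) e

∑<ᶜ : {f : Vec ℕ (suc n) → ℕ} → Comp a → Comp f → Comp (λ xs → ∑< (λ x → f (x ∷ xs)) (a xs))
∑<ᶜ {f = f} aᶜ fᶜ =
  primRecᶜ (λ k xs → ∑< (λ x → f (x ∷ xs)) k) aᶜ (constᶜ 0) (+ᶜ (skip₁ᶜ fᶜ) (varᶜ 1F))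
    (λ _ → refl) λ _ _ → refl

infixr 7 _∧ᵣ_
infixr 6 _∨ᵣ_

≤ᵣ : Comp a → Comp b → Rec (λ xs → a xs ≤ b xs)
≤ᵣ {a = a} {b = b} aᶜ bᶜ = record
  { χ = λ xs → a xs ∸ b xs ; χᶜ = ∸ᶜ aᶜ bᶜ
  ; sound = λ _ → m∸n≡0⇒m≤n ; compl = λ _ → m≤n⇒m∸n≡0 }

_∧ᵣ_ : Rec P → Rec Q → Rec (λ xs → P xs × Q xs)
R ∧ᵣ S = record
  { χ = λ xs → χ R xs + χ S xs ; χᶜ = +ᶜ (χᶜ R) (χᶜ S)
  ; sound = λ xs e → sound R xs (m+n≡0⇒m≡0 _ e) , sound S xs (m+n≡0⇒n≡0 (χ R xs) e)
  ; compl = λ xs (p , q) → cong₂ _+_ (compl R xs p) (compl S xs q) }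

_∨ᵣ_ : Rec P → Rec Q → Rec (λ xs → P xs ⊎ Q xs)
_∨ᵣ_ {P = P} {Q = Q} R S = record
  { χ = λ xs → χ R xs * χ S xs ; χᶜ = *ᶜ (χᶜ R) (χᶜ S) ; sound = snd ; compl = cpl }
  where
  snd : ∀ xs → χ R xs * χ S xs ≡ 0 → P xs ⊎ Q xs
  snd xs e with m*n≡0⇒m≡0∨n≡0 (χ R xs) e
  ... | inj₁ z = inj₁ (sound R xs z)
  ... | inj₂ z = inj₂ (sound S xs z)
  cpl : ∀ xs → P xs ⊎ Q xs → χ R xs * χ S xs ≡ 0
  cpl xs (inj₁ p) rewrite compl R xs p = refl
  cpl xs (inj₂ q) rewrite compl S xs q = *-zeroʳ (χ R xs)

¬ᵣ : Rec P → Rec (λ xs → ¬ P xs)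
¬ᵣ {P = P} R = record
  { χ = λ xs → 1 ∸ χ R xs ; χᶜ = ∸ᶜ (constᶜ 1) (χᶜ R) ; sound = snd ; compl = cpl }
  where
  snd : ∀ xs → 1 ∸ χ R xs ≡ 0 → ¬ P xs
  snd xs e p rewrite compl R xs p = contradiction e 1+n≢0
  cpl : ∀ xs → ¬ P xs → 1 ∸ χ R xs ≡ 0
  cpl xs ¬p with χ R xs in eq
  ... | 0     = contradiction (sound R xs eq) ¬p
  ... | suc k = 0∸n≡0 k

mapᵣ : (∀ xs → P xs → Q xs) → (∀ xs → Q xs → P xs) → Rec P → Rec Q
mapᵣ f g R = record
  { χ = χ R ; χᶜ = χᶜ R
  ; sound = λ xs → f xs ∘ sound R xs ; compl = λ xs → compl R xs ∘ g xs }

<ᵣ : Comp a → Comp b → Rec (λ xs → a xs < b xs)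
<ᵣ aᶜ bᶜ = ≤ᵣ (sucᶜ aᶜ) bᶜ

≡ᵣ : Comp a → Comp b → Rec (λ xs → a xs ≡ b xs)
≡ᵣ aᶜ bᶜ =
  mapᵣ (λ _ (p , q) → ≤-antisym p q) (λ _ e → ≤-reflexive e , ≤-reflexive (sym e))
    (≤ᵣ aᶜ bᶜ ∧ᵣ ≤ᵣ bᶜ aᶜ)

∀<ᵣ : {P : Vec ℕ (suc n) → Set} → Comp a → Rec P → Rec (λ xs → ∀ x → x < a xs → P (x ∷ xs))
∀<ᵣ {a = a} aᶜ R = record
  { χ = λ xs → ∑< (λ x → χ R (x ∷ xs)) (a xs) ; χᶜ = ∑<ᶜ aᶜ (χᶜ R)
  ; sound = λ xs e x x<a → sound R (x ∷ xs) (∑<-zero⁻¹ _ (a xs) e x x<a)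
  ; compl = λ xs h → ∑<-zero _ (a xs) λ x x<a → compl R (x ∷ xs) (h x x<a) }

∃<ᵣ : {P : Vec ℕ (suc n) → Set} → Comp a → Rec P → Rec (λ xs → ∃[ x ] x < a xs × P (x ∷ xs))
∃<ᵣ {a = a} {P = P} aᶜ R =
  mapᵣ (λ xs → find xs (a xs)) (λ xs (x , x<a , p) h → h x x<a p) (¬ᵣ (∀<ᵣ aᶜ (¬ᵣ R)))
  where
  find : ∀ xs n → ¬ (∀ x → x < n → ¬ P (x ∷ xs)) → ∃[ x ] x < n × P (x ∷ xs)
  find xs 0       h = contradiction (λ _ ()) h
  find xs (suc n) h with dec R (n ∷ xs)
  ... | yes p = n , ≤-refl , p
  ... | no ¬p
    with x , x<n , p ← find xs n (λ g → h λ x x<1+n q →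
           [ (λ x<n → g x x<n q) , (λ { refl → ¬p q }) ]′ (m<1+n⇒m<n∨m≡n x<1+n))
    = x , m<n⇒m<1+n x<n , p

at₂ᵣ : {P : Vec ℕ 2 → Set} → Rec P → Comp a → Comp b → Rec (λ xs → P (a xs ∷ b xs ∷ []))
at₂ᵣ R aᶜ bᶜ = record
  { χ = _ ; χᶜ = at₂ (χᶜ R) aᶜ bᶜ ; sound = λ _ → sound R _ ; compl = λ _ → compl R _ }

at₃ᵣ : {P : Vec ℕ 3 → Set} → Rec P → Comp a → Comp b → Comp c →
       Rec (λ xs → P (a xs ∷ b xs ∷ c xs ∷ []))
at₃ᵣ R aᶜ bᶜ cᶜ = record
  { χ = _ ; χᶜ = at₃ (χᶜ R) aᶜ bᶜ cᶜ ; sound = λ _ → sound R _ ; compl = λ _ → compl R _ }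

-- Partial values shifted by one (0 for undefined) and bounded search

guard : ℕ → ℕ → ℕ
guard 0       v = v
guard (suc _) v = 0

guardᶜ : Comp a → Comp b → Comp (λ xs → guard (a xs) (b xs))
guardᶜ aᶜ bᶜ =
  lift₂ guard (caseᶜ (λ xs k → guard k (lookup xs 1F)) (varᶜ 0F) (varᶜ 1F) (constᶜ 0) (λ _ _ → refl)) aᶜ bᶜ

guard-yes : (R : Rec P) → ∀ {xs v} → P xs → guard (χ R xs) v ≡ v
guard-yes R {xs} p rewrite compl R xs p = refl

guard-suc : (R : Rec P) → ∀ {xs v y} → guard (χ R xs) v ≡ suc y → P xs × v ≡ suc y
guard-suc R {xs} e with χ R xs in eq
... | 0 = sound R xs eq , e

orElse : ℕ → ℕ → ℕ
orElse 0       y = y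
orElse (suc x) y = suc x

first : (ℕ → ℕ) → ℕ → ℕ
first g 0       = 0
first g (suc u) = orElse (first g u) (g u)

orElseᶜ : Comp a → Comp b → Comp (λ xs → orElse (a xs) (b xs))
orElseᶜ aᶜ bᶜ =
  lift₂ orElse (caseᶜ (λ xs k → orElse k (lookup xs 1F)) (varᶜ 0F) (varᶜ 1F) (sucᶜ (varᶜ 0F))
    (λ _ _ → refl)) aᶜ bᶜ

firstᶜ : {f : Vec ℕ (suc n) → ℕ} → Comp a → Comp f → Comp (λ xs → first (λ x → f (x ∷ xs)) (a xs))
firstᶜ {f = f} aᶜ fᶜ =
  primRecᶜ (λ k xs → first (λ x → f (x ∷ xs)) k) aᶜ (constᶜ 0) (orElseᶜ (varᶜ 1F) (skip₁ᶜ fᶜ))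
    (λ _ → refl) λ _ _ → refl

first-mono : ∀ g {u v y} → first g u ≡ suc y → u ≤ v → first g v ≡ suc y
first-mono g {v = 0}     e z≤n = e
first-mono g {v = suc v} e u≤v with m≤n⇒m<n∨m≡n u≤v
... | inj₁ u<v rewrite first-mono g {v = v} e (s≤s⁻¹ u<v) = refl
... | inj₂ refl = e

first-zero : ∀ g {u t} → first g u ≡ 0 → t < u → g t ≡ 0
first-zero g {suc u} e t<u with first g u in eq
first-zero g {suc u} e t<u | 0 with m<1+n⇒m<n∨m≡n t<u
... | inj₁ t<u = first-zero g eq t<u
... | inj₂ refl = e

first-sound : ∀ g {u y} → first g u ≡ suc y →
              ∃[ t ] t < u × g t ≡ suc y × (∀ t′ → t′ < t → g t′ ≡ 0)
first-sound g {suc u} e with first g u in eq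
... | 0     = u , ≤-refl , e , λ _ → first-zero g eq
... | suc z with t , t<u , h ← first-sound g (trans eq e) = t , m<n⇒m<1+n t<u , h

first-compl : ∀ g {t u y} → g t ≡ suc y → t < u → ∃[ z ] first g u ≡ suc z
first-compl g {u = u} e t<u with first g u in eq
... | 0     = contradiction (trans (sym (first-zero g eq t<u)) e) 0≢1+n
... | suc z = z , refl

-- Pairing

infix 9 ⟪_,_⟫

opaque
  tri : ℕ → ℕ
  tri 0       = 0
  tri (suc n) = suc n + tri n

  -- The inverse of `tri`, rounded down. It grows by at most one when `p` does, so a single test per
  -- step suffices.
  root : ℕ → ℕ
  root 0       = 0
  root (suc p) = ifz (tri (suc (root p)) ∸ suc p) (suc (root p)) (root p)

  -- Cantor's enumeration of ℕ × ℕ along antidiagonals.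

  ⟪_,_⟫ : ℕ → ℕ → ℕ
  ⟪ a , b ⟫ = tri (a + b) + a

  π₁ π₂ : ℕ → ℕ
  π₁ p = p ∸ tri (root p)
  π₂ p = root p ∸ π₁ p

  triᶜ : Comp a → Comp (λ xs → tri (a xs))
  triᶜ aᶜ = primRecᶜ (λ k _ → tri k) aᶜ (constᶜ 0) (+ᶜ (sucᶜ (varᶜ 0F)) (varᶜ 1F)) (λ _ → refl) λ _ _ → refl

  rootᶜ : Comp a → Comp (λ xs → root (a xs))
  rootᶜ aᶜ =
    primRecᶜ (λ k _ → root k) aᶜ (constᶜ 0)
      (ifzᶜ (∸ᶜ (triᶜ (sucᶜ (varᶜ 1F))) (sucᶜ (varᶜ 0F))) (sucᶜ (varᶜ 1F)) (varᶜ 1F))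
      (λ _ → refl) λ _ _ → refl

  ⟪⟫ᶜ : Comp a → Comp b → Comp (λ xs → ⟪ a xs , b xs ⟫)
  ⟪⟫ᶜ aᶜ bᶜ = +ᶜ (triᶜ (+ᶜ aᶜ bᶜ)) aᶜ

  π₁ᶜ : Comp a → Comp (λ xs → π₁ (a xs))
  π₁ᶜ aᶜ = ∸ᶜ aᶜ (triᶜ (rootᶜ aᶜ))

  π₂ᶜ : Comp a → Comp (λ xs → π₂ (a xs))
  π₂ᶜ aᶜ = ∸ᶜ (rootᶜ aᶜ) (π₁ᶜ aᶜ)

  tri-mono : ∀ {m n} → m ≤ n → tri m ≤ tri n
  tri-mono z≤n       = z≤n
  tri-mono (s≤s m≤n) = +-mono-≤ (s≤s m≤n) (tri-mono m≤n)

  n≤tri : ∀ n → n ≤ tri n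
  n≤tri 0       = z≤n
  n≤tri (suc n) = m≤m+n (suc n) (tri n)

  root-bounds : ∀ p → tri (root p) ≤ p × p < tri (suc (root p))
  root-bounds 0 = z≤n , z<s
  root-bounds (suc p) with lo , hi ← root-bounds p | tri (suc (root p)) ∸ suc p in eq
  ... | 0     = m∸n≡0⇒m≤n eq , +-mono-≤ {1} {2 + root p} (s≤s z≤n) hi
  ... | suc _ = m≤n⇒m≤1+n lo ,
                ≰⇒> λ le → 0≢1+n (trans (sym (m≤n⇒m∸n≡0 le)) eq)

  root-unique : ∀ w p → tri w ≤ p → p < tri (suc w) → root p ≡ w
  root-unique w p lo hi with lo′ , hi′ ← root-bounds p | <-cmp (root p) w
  ... | tri≈ _ e _ = e
  ... | tri< r<w _ _ = contradiction (<-≤-trans hi′ (≤-trans (tri-mono r<w) lo)) (<-irrefl refl)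
  ... | tri> _ _ w<r = contradiction (<-≤-trans hi (≤-trans (tri-mono w<r) lo′)) (<-irrefl refl)

  root-⟪⟫ : ∀ a b → root ⟪ a , b ⟫ ≡ a + b
  root-⟪⟫ a b = root-unique (a + b) _ (m≤m+n _ a)
    (≤-trans (s≤s (≤-reflexive (+-comm _ a))) (+-monoˡ-≤ (tri (a + b)) (s≤s (m≤m+n a b))))

  π₁-⟪⟫ : ∀ a b → π₁ ⟪ a , b ⟫ ≡ a
  π₁-⟪⟫ a b rewrite root-⟪⟫ a b = m+n∸m≡n (tri (a + b)) a

  π₂-⟪⟫ : ∀ a b → π₂ ⟪ a , b ⟫ ≡ b
  π₂-⟪⟫ a b rewrite π₁-⟪⟫ a b | root-⟪⟫ a b = m+n∸m≡n a b

  ⟪π₁,π₂⟫ : ∀ p → ⟪ π₁ p , π₂ p ⟫ ≡ p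
  ⟪π₁,π₂⟫ p with lo , hi ← root-bounds p =
    trans (cong (λ w → tri w + π₁ p) (m+[n∸m]≡n π₁≤root)) (m+[n∸m]≡n lo)
    where
    π₁≤root : π₁ p ≤ root p
    π₁≤root = m≤n+o⇒m∸n≤o p (tri (root p))
      (≤-trans (s≤s⁻¹ hi) (≤-reflexive (+-comm (root p) _)))

  π₁-≤ : ∀ p → π₁ p ≤ p
  π₁-≤ p = m∸n≤m p (tri (root p))

  π₂-≤ : ∀ p → π₂ p ≤ p
  π₂-≤ p = ≤-trans (m∸n≤m (root p) (π₁ p)) (≤-trans (n≤tri _) (proj₁ (root-bounds p)))

  ⟪⟫-mono : ∀ {a b c d} → a ≤ c → b ≤ d → ⟪ a , b ⟫ ≤ ⟪ c , d ⟫
  ⟪⟫-mono a≤c b≤d = +-mono-≤ (tri-mono (+-mono-≤ a≤c b≤d)) a≤c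

m≤⟪m,n⟫ : ∀ m n → m ≤ ⟪ m , n ⟫
m≤⟪m,n⟫ m n = subst (_≤ ⟪ m , n ⟫) (π₁-⟪⟫ m n) (π₁-≤ _)

n≤⟪m,n⟫ : ∀ m n → n ≤ ⟪ m , n ⟫
n≤⟪m,n⟫ m n = subst (_≤ ⟪ m , n ⟫) (π₂-⟪⟫ m n) (π₂-≤ _)

⟪⟫-unique : ∀ {p a b} → π₁ p ≡ a → π₂ p ≡ b → p ≡ ⟪ a , b ⟫
⟪⟫-unique {p} refl refl = sym (⟪π₁,π₂⟫ p)

-- A universal machine

-- Entries of a rearranged stack, as expressions in the old entries. All primitives but `uncons`,
-- which takes an entry apart, are such rearrangements and are treated uniformly.
data Slot (k : ℕ) : Set where
  slot     : Fin k → Slot k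
  nil      : Slot k
  inc decr : Slot k → Slot k
  _∙_      : (e f : Slot k) → Slot k

infixr 7 _∙_

⟦_⟧ˢ : ∀ {k} → Slot k → Vec ℕ k → ℕ
⟦ slot i ⟧ˢ xs = lookup xs i
⟦ nil    ⟧ˢ xs = 0
⟦ inc e  ⟧ˢ xs = suc (⟦ e ⟧ˢ xs)
⟦ decr e ⟧ˢ xs = pred (⟦ e ⟧ˢ xs)
⟦ e ∙ f  ⟧ˢ xs = ⟪ ⟦ e ⟧ˢ xs , ⟦ f ⟧ˢ xs ⟫

data Prim : Set where
  uncons  : Prim
  shuffle : ∀ {k m} → Vec (Slot k) m → Prim

stack : ∀ {k} → Vec ℕ k → ℕ → ℕ
stack []       S = S
stack (x ∷ xs) S = ⟪ x , stack xs S ⟫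

slots : ∀ k → ℕ → Vec ℕ k
slots 0       v = []
slots (suc k) v = π₁ v ∷ slots k (π₂ v)

rest : ℕ → ℕ → ℕ
rest 0       v = v
rest (suc k) v = rest k (π₂ v)

apply : Prim → ℕ → ℕ
apply uncons               v = ⟪ π₁ (π₁ v) , ⟪ π₂ (π₁ v) , π₂ v ⟫ ⟫
apply (shuffle {k = k} es) v = stack (Vec.map (λ e → ⟦ e ⟧ˢ (slots k v)) es) (rest k v)

slots-stack : ∀ {k} (xs : Vec ℕ k) S → slots k (stack xs S) ≡ xs
slots-stack []       S = refl
slots-stack (x ∷ xs) S
  rewrite π₁-⟪⟫ x (stack xs S) | π₂-⟪⟫ x (stack xs S) = cong (x ∷_) (slots-stack xs S)

rest-stack : ∀ {k} (xs : Vec ℕ k) S → rest k (stack xs S) ≡ S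
rest-stack []       S = refl
rest-stack (x ∷ xs) S rewrite π₂-⟪⟫ x (stack xs S) = rest-stack xs S

uncons-stack : ∀ x E S → apply uncons ⟪ ⟪ x , E ⟫ , S ⟫ ≡ ⟪ x , ⟪ E , S ⟫ ⟫
uncons-stack x E S rewrite π₁-⟪⟫ ⟪ x , E ⟫ S | π₂-⟪⟫ ⟪ x , E ⟫ S | π₁-⟪⟫ x E | π₂-⟪⟫ x E = refl

shuffle-stack : ∀ {k m} (es : Vec (Slot k) m) xs S →
                apply (shuffle es) (stack xs S) ≡ stack (Vec.map (λ e → ⟦ e ⟧ˢ xs) es) S
shuffle-stack es xs S rewrite slots-stack xs S | rest-stack xs S = refl

slotᶜ : ∀ {k} (e : Slot k) → Comp a → Comp (λ xs → ⟦ e ⟧ˢ (slots k (a xs)))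
slotᶜ (slot zero)    aᶜ = π₁ᶜ aᶜ
slotᶜ (slot (suc i)) aᶜ = slotᶜ (slot i) (π₂ᶜ aᶜ)
slotᶜ nil            aᶜ = constᶜ 0
slotᶜ (inc e)        aᶜ = sucᶜ (slotᶜ e aᶜ)
slotᶜ (decr e)       aᶜ = predᶜ (slotᶜ e aᶜ)
slotᶜ (e ∙ f)        aᶜ = ⟪⟫ᶜ (slotᶜ e aᶜ) (slotᶜ f aᶜ)

restᶜ : ∀ k → Comp a → Comp (λ xs → rest k (a xs))
restᶜ 0       aᶜ = aᶜ
restᶜ (suc k) aᶜ = restᶜ k (π₂ᶜ aᶜ)

applyᶜ : ∀ p → Comp a → Comp (λ xs → apply p (a xs))
applyᶜ uncons aᶜ = ⟪⟫ᶜ (π₁ᶜ (π₁ᶜ aᶜ)) (⟪⟫ᶜ (π₂ᶜ (π₁ᶜ aᶜ)) (π₂ᶜ aᶜ))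
applyᶜ {a = a} (shuffle {k} es) aᶜ = pushᶜ es
  where
  pushᶜ : ∀ {m} (es : Vec (Slot k) m) →
          Comp (λ xs → stack (Vec.map (λ e → ⟦ e ⟧ˢ (slots k (a xs))) es) (rest k (a xs)))
  pushᶜ []       = restᶜ k aᶜ
  pushᶜ (e ∷ es) = ⟪⟫ᶜ (slotᶜ e aᶜ) (pushᶜ es)

-- Instructions of the stack machine, compilation and its soundness

infixr 6 _⨾_

data Instr : Set where
  op    : ℕ → Instr
  _⨾_   : Instr → Instr → Instr
  while : Instr → Instr

pattern σ₀ = slot zero
pattern σ₁ = slot (suc zero)
pattern σ₂ = slot (suc (suc zero))
pattern σ₃ = slot (suc (suc (suc zero)))

-- Stack layouts, from the top: environment and list of values while arguments are evaluated; rounds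
-- left, rounds done, current value and environment in the loop of a recursion; last value, argument
-- tested and environment in that of a minimisation.
prims : List Prim
prims = uncons
      ∷ shuffle {1} (nil ∷ [])
      ∷ shuffle {2} (inc σ₀ ∷ [])
      ∷ shuffle {2} (σ₀ ∷ [])
      ∷ shuffle {2} (σ₁ ∷ [])
      ∷ shuffle {1} (σ₀ ∷ nil ∷ [])
      ∷ shuffle {1} (σ₀ ∷ σ₀ ∷ [])
      ∷ shuffle {3} (σ₁ ∷ σ₀ ∙ σ₂ ∷ [])
      ∷ shuffle {1} []
      ∷ shuffle {2} (σ₁ ∷ σ₀ ∷ σ₁ ∷ [])
      ∷ shuffle {2} (σ₁ ∷ nil ∷ σ₀ ∷ [])
      ∷ shuffle {4} (σ₁ ∙ σ₂ ∙ σ₃ ∷ decr σ₀ ∷ σ₁ ∷ σ₃ ∷ [])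
      ∷ shuffle {3} (σ₁ ∷ inc σ₂ ∷ σ₀ ∷ [])
      ∷ shuffle {4} (σ₂ ∷ [])
      ∷ shuffle {1} (nil ∙ σ₀ ∷ nil ∷ σ₀ ∷ [])
      ∷ shuffle {3} (inc σ₁ ∙ σ₂ ∷ inc σ₁ ∷ σ₂ ∷ [])
      ∷ shuffle {3} (σ₁ ∷ [])
      ∷ []

pattern unconsᵢ   = op 0
pattern zeroᵢ     = op 1
pattern succᵢ     = op 2
pattern headᵢ     = op 3
pattern tailᵢ     = op 4
pattern openᵢ     = op 5
pattern dupᵢ      = op 6
pattern collectᵢ  = op 7
pattern dropᵢ     = op 8
pattern recInit   = op 9
pattern recBase   = op 10
pattern recEnter  = op 11
pattern recLeave  = op 12
pattern recExit   = op 13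
pattern muInit    = op 14
pattern muNext    = op 15
pattern muExit    = op 16
pattern nopᵢ      = op 17

nth : List Prim → ℕ → Prim
nth []       _       = shuffle {0} []
nth (p ∷ ps) 0       = p
nth (p ∷ ps) (suc j) = nth ps j

nthᶜ : ∀ ps → Comp a → Comp b → Comp (λ xs → apply (nth ps (a xs)) (b xs))
nthᶜ []       aᶜ bᶜ = bᶜ
nthᶜ (p ∷ ps) aᶜ bᶜ =
  lift₂ (λ j v → apply (nth (p ∷ ps) j) v)
    (caseᶜ (λ xs j → apply (nth (p ∷ ps) j) (lookup xs 1F)) (varᶜ 0F) (applyᶜ p (varᶜ 1F))
      (nthᶜ ps (varᶜ 0F) (varᶜ 2F)) λ _ _ → refl) aᶜ bᶜ

-- `k` is only an upper bound on the number of steps. Carrying the pending instructions `K` along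
-- allows statements about an arbitrary continuation, so that runs never have to be cut or
-- concatenated.
data Ends : ℕ → List Instr → ℕ → ℕ → Set where
  done : ∀ {k v} → Ends k [] v v
  exec : ∀ {k K v w j} → Ends k K (apply (nth prims j) v) w → Ends (suc k) (op j ∷ K) v w
  seq  : ∀ {k K v w p q} → Ends k (p ∷ q ∷ K) v w → Ends (suc k) (p ⨾ q ∷ K) v w
  exit : ∀ {k K v w p} → π₁ v ≡ 0 → Ends k K v w → Ends (suc k) (while p ∷ K) v w
  loop : ∀ {k K v w p t} → π₁ v ≡ suc t → Ends k (p ∷ while p ∷ K) v w →
         Ends (suc k) (while p ∷ K) v w

projᵢ : Fin n → Instr
projᵢ zero    = unconsᵢ ⨾ headᵢ
projᵢ (suc i) = unconsᵢ ⨾ tailᵢ ⨾ projᵢ i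

mutual
  compile : Code n → Instr
  compile zero        = zeroᵢ
  compile succ        = unconsᵢ ⨾ succᵢ
  compile (proj i)    = projᵢ i
  compile (comp f gs) = openᵢ ⨾ compile* gs ⨾ dropᵢ ⨾ compile f
  compile (rec f g)   = unconsᵢ ⨾ recInit ⨾ compile f ⨾ recBase ⨾ while (recBody g) ⨾ recExit
  compile (mu f)      = muInit ⨾ compile f ⨾ while (muNext ⨾ compile f) ⨾ muExit

  -- The last argument is evaluated first, because `collectᵢ` puts each value in front of the list.
  compile* : ∀ {m} → Vec (Code n) m → Instr
  compile* []       = nopᵢ
  compile* (g ∷ gs) = compile* gs ⨾ dupᵢ ⨾ compile g ⨾ collectᵢ

  recBody : Code (2 + n) → Instr
  recBody g = recEnter ⨾ compile g ⨾ recLeave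

env : Vec ℕ n → ℕ
env xs = stack xs 0

Ends-suc : ∀ {k K v w} → Ends k K v w → Ends (suc k) K v w
Ends-suc done       = done
Ends-suc (exec d)   = exec (Ends-suc d)
Ends-suc (seq d)    = seq (Ends-suc d)
Ends-suc (exit e d) = exit e (Ends-suc d)
Ends-suc (loop e d) = loop e (Ends-suc d)

-- The bound is weakened back to `k` on purpose: straight-line code leaves it unchanged, and a round
-- of the loop in `mu-sound` lowers it, which is what that recursion terminates by.
exec⁻ : ∀ {k K v v′ w j} → apply (nth prims j) v ≡ v′ → Ends k (op j ∷ K) v w → Ends k K v′ w
exec⁻ refl (exec d) = Ends-suc d

exec⁺ : ∀ {k K v v′ w j} → apply (nth prims j) v ≡ v′ → Ends k K v′ w → Ends (suc k) (op j ∷ K) v w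
exec⁺ refl d = exec d

seq⁻ : ∀ {k K v w p q} → Ends k (p ⨾ q ∷ K) v w → Ends k (p ∷ q ∷ K) v w
seq⁻ (seq d) = Ends-suc d

proj-sound : ∀ {k K w S} (i : Fin n) (xs : Vec ℕ n) →
             Ends k (projᵢ i ∷ K) ⟪ env xs , S ⟫ w → Ends k K ⟪ lookup xs i , S ⟫ w
proj-sound {S = S} zero (x ∷ xs) d =
  exec⁻ (shuffle-stack (σ₀ ∷ []) (x ∷ env xs ∷ []) S) (exec⁻ (uncons-stack x (env xs) S) (seq⁻ d))
proj-sound {S = S} (suc i) (x ∷ xs) d =
  proj-sound i xs (exec⁻ (shuffle-stack (σ₁ ∷ []) (x ∷ env xs ∷ []) S)
    (seq⁻ (exec⁻ (uncons-stack x (env xs) S) (seq⁻ d))))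

mutual
  -- A run cannot halt without getting past `compile c`, so a value of `c` can be read off any
  -- halting run, whatever the continuation.
  compile-sound : ∀ (c : Code n) {k K S w xs} → Ends k (compile c ∷ K) ⟪ env xs , S ⟫ w →
                  ∃[ y ] c [ xs ]⇓ y × Ends k K ⟪ y , S ⟫ w
  compile-sound zero {S = S} {xs = []} d =
    0 , ⇓-zero , exec⁻ (shuffle-stack (nil ∷ []) (0 ∷ []) S) d
  compile-sound succ {S = S} {xs = x ∷ []} d =
    suc x , ⇓-succ ,
    exec⁻ (shuffle-stack (inc σ₀ ∷ []) (x ∷ 0 ∷ []) S) (exec⁻ (uncons-stack x 0 S) (seq⁻ d))
  compile-sound (proj i) {xs = xs} d = lookup xs i , ⇓-proj , proj-sound i xs d
  compile-sound (comp f gs) {S = S} {xs = xs} d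
    with ys , gs⇓ , d ← compile*-sound gs {xs = xs}
                          (seq⁻ (exec⁻ (shuffle-stack (σ₀ ∷ nil ∷ []) (env xs ∷ []) S) (seq⁻ d)))
    with y , f⇓ , d ← compile-sound f (exec⁻ (shuffle-stack [] (env xs ∷ []) _) (seq⁻ d))
    = y , ⇓-comp gs⇓ f⇓ , d
  compile-sound (rec f g) {S = S} {xs = n ∷ xs} d
    with r , f⇓ , d ← compile-sound f {xs = xs}
                      (seq⁻ (exec⁻ (shuffle-stack (σ₁ ∷ σ₀ ∷ σ₁ ∷ []) (n ∷ env xs ∷ []) S)
                        (seq⁻ (exec⁻ (uncons-stack n (env xs) S) (seq⁻ d)))))
    with y , g⇓ , d ← rec-sound f g n (⇓-rec₀ f⇓)
                        (seq⁻ (exec⁻ (shuffle-stack (σ₁ ∷ nil ∷ σ₀ ∷ []) (r ∷ n ∷ []) _) (seq⁻ d)))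
    = y , subst (λ m → rec f g [ m ∷ xs ]⇓ y) (+-identityʳ n) g⇓ ,
      exec⁻ (shuffle-stack (σ₂ ∷ []) (0 ∷ n + 0 ∷ y ∷ env xs ∷ []) S) d
  compile-sound (mu f) {k = k} {S = S} {xs = xs} d
    with t , f⇓ , d ← compile-sound f {xs = 0 ∷ xs}
                      (seq⁻ (exec⁻ (shuffle-stack (nil ∙ σ₀ ∷ nil ∷ σ₀ ∷ []) (env xs ∷ []) S) (seq⁻ d)))
    with y , mu⇓ , d ← mu-sound f k (λ _ ()) f⇓ (seq⁻ d)
    = y , mu⇓ , exec⁻ (shuffle-stack (σ₁ ∷ []) (0 ∷ y ∷ env xs ∷ []) S) d

  compile*-sound : ∀ {m} (gs : Vec (Code n) m) {k K S w xs} →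
                   Ends k (compile* gs ∷ K) ⟪ env xs , ⟪ 0 , S ⟫ ⟫ w →
                   Σ (Vec ℕ m) λ ys → Pointwise (λ g y → g [ xs ]⇓ y) gs ys ×
                           Ends k K ⟪ env xs , ⟪ env ys , S ⟫ ⟫ w
  compile*-sound [] d = [] , [] , exec⁻ refl d
  compile*-sound (g ∷ gs) {S = S} {xs = xs} d
    with ys , gs⇓ , d ← compile*-sound gs {xs = xs} (seq⁻ d)
    with y , g⇓ , d ← compile-sound g {xs = xs}
                      (seq⁻ (exec⁻ (shuffle-stack (σ₀ ∷ σ₀ ∷ []) (env xs ∷ []) _) (seq⁻ d)))
    = y ∷ ys , g⇓ ∷ gs⇓ ,
      exec⁻ (shuffle-stack (σ₁ ∷ σ₀ ∙ σ₂ ∷ []) (y ∷ env xs ∷ env ys ∷ []) S) d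

  -- `m` rounds are left and `j` are done; the sum, which is the recursion argument, is the loop
  -- invariant.
  rec-sound : ∀ (f : Code n) g m {k K S w j r xs} → rec f g [ j ∷ xs ]⇓ r →
              Ends k (while (recBody g) ∷ K) ⟪ m , ⟪ j , ⟪ r , ⟪ env xs , S ⟫ ⟫ ⟫ ⟫ w →
              ∃[ y ] rec f g [ m + j ∷ xs ]⇓ y ×
                     Ends k K ⟪ 0 , ⟪ m + j , ⟪ y , ⟪ env xs , S ⟫ ⟫ ⟫ ⟫ w
  rec-sound f g 0 {r = r} r⇓ (exit _ d) = r , r⇓ , Ends-suc d
  rec-sound f g 0 r⇓ (loop e d) = contradiction (trans (sym (π₁-⟪⟫ 0 _)) e) 0≢1+n
  rec-sound f g (suc m) r⇓ (exit e d) = contradiction (trans (sym (π₁-⟪⟫ (suc m) _)) e) 1+n≢0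
  rec-sound f g (suc m) {S = S} {j = j} {r = r} {xs = xs} r⇓ (loop _ d)
    with r′ , g⇓ , d ← compile-sound g {xs = j ∷ r ∷ xs}
                         (seq⁻ (exec⁻ (shuffle-stack (σ₁ ∙ σ₂ ∙ σ₃ ∷ decr σ₀ ∷ σ₁ ∷ σ₃ ∷ [])
                                        (suc m ∷ j ∷ r ∷ env xs ∷ []) S) (seq⁻ d)))
    with y , y⇓ , d ← rec-sound f g m (⇓-rec₊ r⇓ g⇓)
                        (exec⁻ (shuffle-stack (σ₁ ∷ inc σ₂ ∷ σ₀ ∷ []) (r′ ∷ m ∷ j ∷ []) ⟪ env xs , S ⟫) d)
    rewrite +-suc m j
    = y , y⇓ , Ends-suc d

  mu-sound : ∀ (f : Code (suc n)) k {K S w z t xs} → (∀ y → y < z → ∃[ i ] f [ y ∷ xs ]⇓ suc i) →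
             f [ z ∷ xs ]⇓ t →
             Ends k (while (muNext ⨾ compile f) ∷ K) ⟪ t , ⟪ z , ⟪ env xs , S ⟫ ⟫ ⟫ w →
             ∃[ y ] mu f [ xs ]⇓ y × Ends k K ⟪ 0 , ⟪ y , ⟪ env xs , S ⟫ ⟫ ⟫ w
  mu-sound f (suc k) {z = z} {t = 0} below t⇓ (exit _ d) = z , ⇓-mu below t⇓ , Ends-suc d
  mu-sound f (suc k) {t = 0} below t⇓ (loop e d) = contradiction (trans (sym (π₁-⟪⟫ 0 _)) e) 0≢1+n
  mu-sound f (suc k) {t = suc t} below t⇓ (exit e d) = contradiction (trans (sym (π₁-⟪⟫ (suc t) _)) e) 1+n≢0
  mu-sound f (suc k) {S = S} {z = z} {t = suc t} {xs = xs} below t⇓ (loop _ d)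
    with t′ , t′⇓ , d ← compile-sound f {xs = suc z ∷ xs}
                         (exec⁻ (shuffle-stack (inc σ₁ ∙ σ₂ ∷ inc σ₁ ∷ σ₂ ∷ [])
                                        (suc t ∷ z ∷ env xs ∷ []) S) (seq⁻ d))
    with y , mu⇓ , d ← mu-sound f k {z = suc z}
                       (λ y y≤z → [ below y , (λ { refl → t , t⇓ }) ]′ (m<1+n⇒m<n∨m≡n y≤z)) t′⇓ d
    = y , mu⇓ , Ends-suc d

-- Completeness of the compilation

Halts : List Instr → ℕ → ℕ → Set
Halts K v w = ∃[ k ] Ends k K v w

exec⇓ : ∀ {K v v′ w j} → apply (nth prims j) v ≡ v′ → Halts K v′ w → Halts (op j ∷ K) v w
exec⇓ e (k , d) = suc k , exec⁺ e d

seq⇓ : ∀ {K v w p q} → Halts (p ∷ q ∷ K) v w → Halts (p ⨾ q ∷ K) v w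
seq⇓ (k , d) = suc k , seq d

exit⇓ : ∀ {K v w p} → Halts K ⟪ 0 , v ⟫ w → Halts (while p ∷ K) ⟪ 0 , v ⟫ w
exit⇓ (k , d) = suc k , exit (π₁-⟪⟫ 0 _) d

loop⇓ : ∀ {K v w p t} → Halts (p ∷ while p ∷ K) ⟪ suc t , v ⟫ w → Halts (while p ∷ K) ⟪ suc t , v ⟫ w
loop⇓ (k , d) = suc k , loop (π₁-⟪⟫ _ _) d

proj-complete : ∀ {K w S} (i : Fin n) (xs : Vec ℕ n) →
                Halts K ⟪ lookup xs i , S ⟫ w → Halts (projᵢ i ∷ K) ⟪ env xs , S ⟫ w
proj-complete {S = S} zero (x ∷ xs) d =
  seq⇓ (exec⇓ (uncons-stack x (env xs) S) (exec⇓ (shuffle-stack (σ₀ ∷ []) (x ∷ env xs ∷ []) S) d))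
proj-complete {S = S} (suc i) (x ∷ xs) d =
  seq⇓ (exec⇓ (uncons-stack x (env xs) S)
    (seq⇓ (exec⇓ (shuffle-stack (σ₁ ∷ []) (x ∷ env xs ∷ []) S) (proj-complete i xs d))))

mutual
  -- Runs are built from their end: a halting run of the continuation is prolonged backwards.
  compile-complete : ∀ (c : Code n) {K S w xs y} → c [ xs ]⇓ y → Halts K ⟪ y , S ⟫ w →
                     Halts (compile c ∷ K) ⟪ env xs , S ⟫ w
  compile-complete zero {S = S} ⇓-zero d = exec⇓ (shuffle-stack (nil ∷ []) (0 ∷ []) S) d
  compile-complete succ {S = S} (⇓-succ {x}) d =
    seq⇓ (exec⇓ (uncons-stack x 0 S) (exec⇓ (shuffle-stack (inc σ₀ ∷ []) (x ∷ 0 ∷ []) S) d))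
  compile-complete (proj i) {xs = xs} ⇓-proj d = proj-complete i xs d
  compile-complete (comp f gs) {S = S} {xs = xs} (⇓-comp {ys = ys} gs⇓ f⇓) d =
    seq⇓ (exec⇓ (shuffle-stack (σ₀ ∷ nil ∷ []) (env xs ∷ []) S) (seq⇓ (compile*-complete gs gs⇓
      (seq⇓ (exec⇓ (shuffle-stack [] (env xs ∷ []) ⟪ env ys , S ⟫) (compile-complete f f⇓ d))))))
  compile-complete (rec f g) {S = S} {xs = n ∷ xs} {y = y} rec⇓ d =
    seq⇓ (exec⇓ (uncons-stack n (env xs) S)
      (seq⇓ (exec⇓ (shuffle-stack (σ₁ ∷ σ₀ ∷ σ₁ ∷ []) (n ∷ env xs ∷ []) S)
        (seq⇓ (rec-complete f g rec⇓ 0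
          (exit⇓ (exec⇓ (shuffle-stack (σ₂ ∷ []) (0 ∷ n ∷ y ∷ env xs ∷ []) S) d)))))))
  compile-complete (mu f) {K = K} {S = S} {w = w} {xs = xs} (⇓-mu {y = y} below f⇓) d =
    start (descend y ≤-refl (0 , f⇓ ,
      exit⇓ (exec⇓ (shuffle-stack (σ₁ ∷ []) (0 ∷ y ∷ env xs ∷ []) S) d)))
    where
    At : ℕ → Set
    At z = ∃[ t ] f [ z ∷ xs ]⇓ t ×
      Halts (while (muNext ⨾ compile f) ∷ muExit ∷ K) ⟪ t , ⟪ z , ⟪ env xs , S ⟫ ⟫ ⟫ w
    -- The known halting run starts at the last test `y`, so the rounds are prepended from `y` down
    -- to 0.
    descend : ∀ z → z ≤ y → At z → At 0
    descend 0       _   h = h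
    descend (suc z) z<y (t′ , t′⇓ , h) with t , t⇓ ← below z z<y =
      descend z (<⇒≤ z<y) (suc t , t⇓ , loop⇓ (seq⇓
        (exec⇓ (shuffle-stack (inc σ₁ ∙ σ₂ ∷ inc σ₁ ∷ σ₂ ∷ []) (suc t ∷ z ∷ env xs ∷ []) S)
          (compile-complete f t′⇓ h))))
    start : At 0 → Halts (compile (mu f) ∷ K) ⟪ env xs , S ⟫ w
    start (t , t⇓ , h) =
      seq⇓ (exec⇓ (shuffle-stack (nil ∙ σ₀ ∷ nil ∷ σ₀ ∷ []) (env xs ∷ []) S)
        (seq⇓ (compile-complete f t⇓ (seq⇓ h))))

  compile*-complete : ∀ {m} (gs : Vec (Code n) m) {K S w xs} {ys : Vec ℕ m} →
                      Pointwise (λ g y → g [ xs ]⇓ y) gs ys →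
                      Halts K ⟪ env xs , ⟪ env ys , S ⟫ ⟫ w →
                      Halts (compile* gs ∷ K) ⟪ env xs , ⟪ 0 , S ⟫ ⟫ w
  compile*-complete [] [] d = exec⇓ refl d
  compile*-complete (g ∷ gs) {S = S} {xs = xs} {ys = y ∷ ys} (g⇓ ∷ gs⇓) d =
    seq⇓ (compile*-complete gs gs⇓ (seq⇓ (exec⇓ (shuffle-stack (σ₀ ∷ σ₀ ∷ []) (env xs ∷ []) ⟪ env ys , S ⟫)
      (seq⇓ (compile-complete g g⇓
        (exec⇓ (shuffle-stack (σ₁ ∷ σ₀ ∙ σ₂ ∷ []) (y ∷ env xs ∷ env ys ∷ []) S) d))))))

  rec-complete : ∀ (f : Code n) g {K S w j r xs} → rec f g [ j ∷ xs ]⇓ r → ∀ m →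
                 Halts (while (recBody g) ∷ recExit ∷ K) ⟪ m , ⟪ j , ⟪ r , ⟪ env xs , S ⟫ ⟫ ⟫ ⟫ w →
                 Halts (compile f ∷ recBase ⨾ while (recBody g) ⨾ recExit ∷ K)
                   ⟪ env xs , ⟪ m + j , ⟪ env xs , S ⟫ ⟫ ⟫ w
  rec-complete f g {S = S} {r = r} {xs = xs} (⇓-rec₀ f⇓) m d rewrite +-identityʳ m =
    compile-complete f f⇓
      (seq⇓ (exec⇓ (shuffle-stack (σ₁ ∷ nil ∷ σ₀ ∷ []) (r ∷ m ∷ []) ⟪ env xs , S ⟫) (seq⇓ d)))
  rec-complete f g {S = S} {xs = xs} (⇓-rec₊ {k = j} {r = r} {y = y} r⇓ g⇓) m d rewrite +-suc m j =
    rec-complete f g r⇓ (suc m) (loop⇓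
      (seq⇓ (exec⇓ (shuffle-stack (σ₁ ∙ σ₂ ∙ σ₃ ∷ decr σ₀ ∷ σ₁ ∷ σ₃ ∷ []) (suc m ∷ j ∷ r ∷ env xs ∷ []) S)
        (seq⇓ (compile-complete g g⇓
          (exec⇓ (shuffle-stack (σ₁ ∷ inc σ₂ ∷ σ₀ ∷ []) (y ∷ m ∷ j ∷ []) ⟪ env xs , S ⟫) d))))))

-- Gödel numbers and the step function

⌜_⌝ : Instr → ℕ
⌜ op j    ⌝ = ⟪ 0 , ⟪ j , 0 ⟫ ⟫
⌜ p ⨾ q   ⌝ = ⟪ 1 , ⟪ ⌜ p ⌝ , ⌜ q ⌝ ⟫ ⟫
⌜ while p ⌝ = ⟪ 2 , ⟪ ⌜ p ⌝ , 0 ⟫ ⟫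

⌜_⌝* : List Instr → ℕ
⌜ []    ⌝* = 0
⌜ p ∷ K ⌝* = suc ⟪ ⌜ p ⌝ , ⌜ K ⌝* ⟫

stepWhile : ℕ → ℕ → ℕ → ℕ → ℕ
stepWhile 0       p K v = ⟪ K , v ⟫
stepWhile (suc _) p K v = ⟪ suc ⟪ p , suc ⟪ ⟪ 2 , ⟪ p , 0 ⟫ ⟫ , K ⟫ ⟫ , v ⟫

stepInstr : ℕ → ℕ → ℕ → ℕ → ℕ
stepInstr 0             arg K v = ⟪ K , apply (nth prims (π₁ arg)) v ⟫
stepInstr 1             arg K v = ⟪ suc ⟪ π₁ arg , suc ⟪ π₂ arg , K ⟫ ⟫ , v ⟫
stepInstr (suc (suc _)) arg K v = stepWhile (π₁ v) (π₁ arg) K v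

stepControl : ℕ → ℕ → ℕ
stepControl 0       v = ⟪ 0 , v ⟫
stepControl (suc K) v = stepInstr (π₁ (π₁ K)) (π₂ (π₁ K)) (π₂ K) v

step : ℕ → ℕ
step σ = stepControl (π₁ σ) (π₂ σ)

run : ℕ → ℕ → ℕ
run 0       σ = σ
run (suc k) σ = step (run k σ)

stepWhileᶜ : Comp a → Comp b → Comp c → Comp d →
             Comp (λ xs → stepWhile (a xs) (b xs) (c xs) (d xs))
stepWhileᶜ = lift₄ stepWhile
  (caseᶜ (λ xs t → stepWhile t (lookup xs 1F) (lookup xs 2F) (lookup xs 3F)) (varᶜ 0F)
    (⟪⟫ᶜ (varᶜ 2F) (varᶜ 3F))
    (⟪⟫ᶜ (sucᶜ (⟪⟫ᶜ (varᶜ 2F) (sucᶜ (⟪⟫ᶜ (⟪⟫ᶜ (constᶜ 2) (⟪⟫ᶜ (varᶜ 2F) (constᶜ 0))) (varᶜ 3F)))))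
      (varᶜ 4F))
    λ _ _ → refl)

stepInstrᶜ : Comp a → Comp b → Comp c → Comp d →
             Comp (λ xs → stepInstr (a xs) (b xs) (c xs) (d xs))
stepInstrᶜ = lift₄ stepInstr
  (caseᶜ (λ xs t → stepInstr t (lookup xs 1F) (lookup xs 2F) (lookup xs 3F)) (varᶜ 0F)
    (⟪⟫ᶜ (varᶜ 2F) (nthᶜ prims (π₁ᶜ (varᶜ 1F)) (varᶜ 3F)))
    (caseᶜ (λ xs t → stepInstr (suc t) (lookup xs 2F) (lookup xs 3F) (lookup xs 4F)) (varᶜ 0F)
      (⟪⟫ᶜ (sucᶜ (⟪⟫ᶜ (π₁ᶜ (varᶜ 2F)) (sucᶜ (⟪⟫ᶜ (π₂ᶜ (varᶜ 2F)) (varᶜ 3F))))) (varᶜ 4F))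
      (stepWhileᶜ (π₁ᶜ (varᶜ 5F)) (π₁ᶜ (varᶜ 3F)) (varᶜ 4F) (varᶜ 5F))
      λ _ _ → refl)
    λ _ _ → refl)

stepControlᶜ : Comp a → Comp b → Comp (λ xs → stepControl (a xs) (b xs))
stepControlᶜ = lift₂ stepControl
  (caseᶜ (λ xs K → stepControl K (lookup xs 1F)) (varᶜ 0F) (⟪⟫ᶜ (constᶜ 0) (varᶜ 1F))
    (stepInstrᶜ (π₁ᶜ (π₁ᶜ (varᶜ 0F))) (π₂ᶜ (π₁ᶜ (varᶜ 0F))) (π₂ᶜ (varᶜ 0F)) (varᶜ 2F))
    λ _ _ → refl)

runᶜ : Comp a → Comp b → Comp (λ xs → run (a xs) (b xs))
runᶜ {b = b} aᶜ bᶜ =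
  primRecᶜ (λ k xs → run k (b xs)) aᶜ bᶜ (stepControlᶜ (π₁ᶜ (varᶜ 1F)) (π₂ᶜ (varᶜ 1F)))
    (λ _ → refl) λ _ _ → refl

step-⟪⟫ : ∀ K v → step ⟪ K , v ⟫ ≡ stepControl K v
step-⟪⟫ K v rewrite π₁-⟪⟫ K v | π₂-⟪⟫ K v = refl

step-∷ : ∀ t arg K v → step ⟪ suc ⟪ ⟪ t , arg ⟫ , K ⟫ , v ⟫ ≡ stepInstr t arg K v
step-∷ t arg K v
  rewrite step-⟪⟫ (suc ⟪ ⟪ t , arg ⟫ , K ⟫) v | π₁-⟪⟫ ⟪ t , arg ⟫ K | π₂-⟪⟫ ⟪ t , arg ⟫ K
        | π₁-⟪⟫ t arg | π₂-⟪⟫ t arg = refl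

step-op : ∀ j K v → step ⟪ ⌜ op j ∷ K ⌝* , v ⟫ ≡ ⟪ ⌜ K ⌝* , apply (nth prims j) v ⟫
step-op j K v rewrite step-∷ 0 ⟪ j , 0 ⟫ ⌜ K ⌝* v | π₁-⟪⟫ j 0 = refl

step-⨾ : ∀ p q K v → step ⟪ ⌜ p ⨾ q ∷ K ⌝* , v ⟫ ≡ ⟪ ⌜ p ∷ q ∷ K ⌝* , v ⟫
step-⨾ p q K v
  rewrite step-∷ 1 ⟪ ⌜ p ⌝ , ⌜ q ⌝ ⟫ ⌜ K ⌝* v | π₁-⟪⟫ ⌜ p ⌝ ⌜ q ⌝ | π₂-⟪⟫ ⌜ p ⌝ ⌜ q ⌝ = refl

step-while : ∀ p K v → step ⟪ ⌜ while p ∷ K ⌝* , v ⟫ ≡ stepWhile (π₁ v) ⌜ p ⌝ ⌜ K ⌝* v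
step-while p K v rewrite step-∷ 2 ⟪ ⌜ p ⌝ , 0 ⟫ ⌜ K ⌝* v | π₁-⟪⟫ ⌜ p ⌝ 0 = refl

-- `run` adds its steps at the end, as primitive recursion requires, whereas `Ends` consumes them
-- from the front.
run-step : ∀ k σ → run k (step σ) ≡ run (suc k) σ
run-step 0       σ = refl
run-step (suc k) σ = cong step (run-step k σ)

run-halted : ∀ k v → run k ⟪ 0 , v ⟫ ≡ ⟪ 0 , v ⟫
run-halted 0       v = refl
run-halted (suc k) v rewrite run-halted k v = step-⟪⟫ 0 v

Ends⇒run : ∀ {k K v w} → Ends k K v w → run k ⟪ ⌜ K ⌝* , v ⟫ ≡ ⟪ 0 , w ⟫
Ends⇒run {k} {v = v} done = run-halted k v
Ends⇒run {suc k} {op j ∷ K} {v} (exec d) =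
  trans (sym (run-step k _)) (trans (cong (run k) (step-op j K v)) (Ends⇒run d))
Ends⇒run {suc k} {p ⨾ q ∷ K} {v} (seq d) =
  trans (sym (run-step k _)) (trans (cong (run k) (step-⨾ p q K v)) (Ends⇒run d))
Ends⇒run {suc k} {while p ∷ K} {v} (exit e d) =
  trans (sym (run-step k _)) (trans (cong (run k) (trans (step-while p K v)
    (cong (λ t → stepWhile t ⌜ p ⌝ ⌜ K ⌝* v) e))) (Ends⇒run d))
Ends⇒run {suc k} {while p ∷ K} {v} (loop e d) =
  trans (sym (run-step k _)) (trans (cong (run k) (trans (step-while p K v)
    (cong (λ t → stepWhile t ⌜ p ⌝ ⌜ K ⌝* v) e))) (Ends⇒run d))

run⇒Ends : ∀ k K {v w} → run k ⟪ ⌜ K ⌝* , v ⟫ ≡ ⟪ 0 , w ⟫ → Ends k K v w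
run⇒Ends k [] {v} {w} e
  with refl ← trans (sym (π₂-⟪⟫ 0 v)) (trans (cong π₂ (trans (sym (run-halted k v)) e)) (π₂-⟪⟫ 0 w)) = done
run⇒Ends 0 (p ∷ K) e =
  contradiction (trans (sym (π₁-⟪⟫ _ _)) (trans (cong π₁ e) (π₁-⟪⟫ 0 _))) 1+n≢0
run⇒Ends (suc k) (op j ∷ K) {v} e =
  exec (run⇒Ends k K (trans (cong (run k) (sym (step-op j K v))) (trans (run-step k _) e)))
run⇒Ends (suc k) (p ⨾ q ∷ K) {v} e =
  seq (run⇒Ends k (p ∷ q ∷ K) (trans (cong (run k) (sym (step-⨾ p q K v))) (trans (run-step k _) e)))
run⇒Ends (suc k) (while p ∷ K) {v} {w} e = branch (π₁ v) refl
  where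
  next : ∀ t → π₁ v ≡ t → run k (stepWhile t ⌜ p ⌝ ⌜ K ⌝* v) ≡ ⟪ 0 , w ⟫
  next t eq = trans (cong (run k) (sym (trans (step-while p K v)
    (cong (λ t → stepWhile t ⌜ p ⌝ ⌜ K ⌝* v) eq)))) (trans (run-step k _) e)
  branch : ∀ t → π₁ v ≡ t → Ends (suc k) (while p ∷ K) v w
  branch 0       eq = exit eq (run⇒Ends k K (next 0 eq))
  branch (suc t) eq = loop eq (run⇒Ends k (p ∷ while p ∷ K) (next (suc t) eq))

result : ℕ → ℕ
result σ = ifz (π₁ σ) (suc (π₁ (π₂ σ))) 0

result-halted : ∀ σ {y} → result σ ≡ suc y → σ ≡ ⟪ 0 , π₂ σ ⟫ × π₁ (π₂ σ) ≡ y
result-halted σ e with π₁ σ in eq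
... | 0 = ⟪⟫-unique eq refl , suc-injective e

result-step : ∀ σ {y} → result σ ≡ suc y → result (step σ) ≡ suc y
result-step σ e with h , _ ← result-halted σ e =
  trans (cong result (trans (cong step h) (trans (step-⟪⟫ 0 _) (sym h)))) e

index : Code n → ℕ
index c = ⌜ compile c ⌝

opaque
  -- The value computed within k steps by program i on the environment E, shifted
  -- by one; 0 while the program is still running.

  U : ℕ → ℕ → ℕ → ℕ
  U i E k = result (run k ⟪ suc ⟪ i , 0 ⟫ , ⟪ E , 0 ⟫ ⟫)

  Uᶜ : Comp a → Comp b → Comp c → Comp (λ xs → U (a xs) (b xs) (c xs))
  Uᶜ {a = a} {b = b} {c = c} aᶜ bᶜ cᶜ = ifzᶜ (π₁ᶜ σᶜ) (sucᶜ (π₁ᶜ (π₂ᶜ σᶜ))) (constᶜ 0)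
    where
    σᶜ : Comp (λ xs → run (c xs) ⟪ suc ⟪ a xs , 0 ⟫ , ⟪ b xs , 0 ⟫ ⟫)
    σᶜ = runᶜ cᶜ (⟪⟫ᶜ (sucᶜ (⟪⟫ᶜ aᶜ (constᶜ 0))) (⟪⟫ᶜ bᶜ (constᶜ 0)))

  U-mono : ∀ i E {k l y} → U i E k ≡ suc y → k ≤ l → U i E l ≡ suc y
  U-mono i E {l = 0}     e z≤n = e
  U-mono i E {l = suc l} e k≤l with m≤n⇒m<n∨m≡n k≤l
  ... | inj₂ refl = e
  ... | inj₁ k<l  = result-step (run l _) (U-mono i E {l = l} e (s≤s⁻¹ k<l))

  U-complete : ∀ (c : Code n) {xs y} → c [ xs ]⇓ y → ∃[ k ] U (index c) (env xs) k ≡ suc y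
  U-complete c {xs} {y} c⇓ with k , d ← compile-complete c {K = []} {S = 0} c⇓ (0 , done) =
    k , trans (cong result (Ends⇒run d)) eq
    where
    eq : result ⟪ 0 , ⟪ y , 0 ⟫ ⟫ ≡ suc y
    eq rewrite π₁-⟪⟫ 0 ⟪ y , 0 ⟫ | π₂-⟪⟫ 0 ⟪ y , 0 ⟫ | π₁-⟪⟫ y 0 = refl

  U-sound : ∀ (c : Code n) {xs k y} → U (index c) (env xs) k ≡ suc y → c [ xs ]⇓ y
  U-sound c {xs} {k} e with h , refl ← result-halted _ e
    with y , c⇓ , d ← compile-sound c {xs = xs} (run⇒Ends k (compile c ∷ []) h)
    = subst (c [ xs ]⇓_) (trans (sym (π₁-⟪⟫ y 0)) (cong π₁ (halted d))) c⇓
    where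
    halted : ∀ {k v w} → Ends k [] v w → v ≡ w
    halted done = refl

-- The numbering

-- Stage s of program i: entry w = ⟪ x , k ⟫ is the outcome on x after k steps,
-- so that each stage adds at most one point to the domain.

opaque
  sameᵣ : Rec {2} (λ xs → lookup xs 0F ≡ lookup xs 1F)
  sameᵣ = ≡ᵣ (varᶜ 0F) (varᶜ 1F)

entry : ℕ → ℕ → ℕ → ℕ
entry i x w = guard (χ sameᵣ (π₁ w ∷ x ∷ [])) (U i ⟪ x , 0 ⟫ (π₂ w))

tab : ℕ → ℕ → ℕ → ℕ
tab s i x = first (entry i x) s

tabᶜ : Comp a → Comp b → Comp c → Comp (λ xs → tab (a xs) (b xs) (c xs))
tabᶜ = lift₃ tab (firstᶜ (varᶜ 0F)
  (guardᶜ (at₂ (χᶜ sameᵣ) (π₁ᶜ (varᶜ 0F)) (varᶜ 3F))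
    (Uᶜ (varᶜ 2F) (⟪⟫ᶜ (varᶜ 3F) (constᶜ 0)) (π₂ᶜ (varᶜ 0F)))))

parity : (ℕ → ℕ) → ℕ → ℕ
parity d 0       = 0
parity d (suc n) = ifz (d n) (parity d n) (1 ∸ parity d n)

parityᶜ : {f : Vec ℕ (suc n) → ℕ} → Comp a → Comp f → Comp (λ xs → parity (λ x → f (x ∷ xs)) (a xs))
parityᶜ {f = f} aᶜ fᶜ =
  primRecᶜ (λ k xs → parity (λ x → f (x ∷ xs)) k) aᶜ (constᶜ 0)
    (ifzᶜ (skip₁ᶜ fᶜ) (varᶜ 1F) (∸ᶜ (constᶜ 1) (varᶜ 1F))) (λ _ → refl) λ _ _ → refl

-- Only the parity of the size. No point is missed, since `tab s i` is undefined from `s` on.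
size : ℕ → ℕ → ℕ
size s i = parity (tab s i) s

sizeᶜ : Comp a → Comp b → Comp (λ xs → size (a xs) (b xs))
sizeᶜ = lift₂ size (parityᶜ (varᶜ 0F) (tabᶜ (varᶜ 1F) (varᶜ 2F) (varᶜ 0F)))

-- Updated only at the stages at which the domain has even size, so that the
-- limit is infinite or of even size.

evenTab : ℕ → ℕ → ℕ → ℕ
evenTab 0       i x = 0
evenTab (suc s) i x = ifz (size (suc s) i) (tab (suc s) i x) (evenTab s i x)

evenTabᶜ : Comp a → Comp b → Comp c → Comp (λ xs → evenTab (a xs) (b xs) (c xs))
evenTabᶜ = lift₃ evenTab
  (primRecᶜ (λ s xs → evenTab s (lookup xs 1F) (lookup xs 2F)) (varᶜ 0F) (constᶜ 0)
    (ifzᶜ (sizeᶜ (sucᶜ (varᶜ 0F)) (varᶜ 3F)) (tabᶜ (sucᶜ (varᶜ 0F)) (varᶜ 3F) (varᶜ 4F)) (varᶜ 1F))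
    (λ _ → refl) λ _ _ → refl)

-- Program π₁ z stopped at stage π₂ z; the point π₂ z is added if that makes the
-- size of the domain odd.

frozenTab : ℕ → ℕ → ℕ
frozenTab z x = orElse (tab (π₂ z) (π₁ z) x)
  (ifz (size (π₂ z) (π₁ z)) (guard (χ sameᵣ (x ∷ π₂ z ∷ [])) 1) 0)

frozenTabᶜ : Comp a → Comp b → Comp (λ xs → frozenTab (a xs) (b xs))
frozenTabᶜ = lift₂ frozenTab (orElseᶜ (tabᶜ (π₂ᶜ (varᶜ 0F)) (π₁ᶜ (varᶜ 0F)) (varᶜ 1F))
  (ifzᶜ (sizeᶜ (π₂ᶜ (varᶜ 0F)) (π₁ᶜ (varᶜ 0F)))
    (guardᶜ (at₂ (χᶜ sameᵣ) (varᶜ 1F) (π₂ᶜ (varᶜ 0F))) (constᶜ 1)) (constᶜ 0)))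

Hit : ℕ → ℕ → ℕ → Set
Hit u f q = ∃[ n ] n < u × tab u f n ≡ suc q

opaque
  hitᵣ : Rec {3} (λ xs → Hit (lookup xs 0F) (lookup xs 1F) (lookup xs 2F))
  hitᵣ = ∃<ᵣ (varᶜ 0F) (≡ᵣ (tabᶜ (varᶜ 1F) (varᶜ 2F) (varᶜ 0F)) (sucᶜ (varᶜ 3F)))

-- The pair number m = ⟪ e , k ⟫ consists of the programs ⟪ 0 , m ⟫ and
-- ⟪ 1 , m ⟫.  Program f has to hit both programs of every pair with f < e, and
-- works on these pairs in order of m.

Reach : ℕ → ℕ → ℕ → Set
Reach u f m = ∀ m′ → m′ < m → π₁ m′ ≤ f ⊎ Hit u f ⟪ 0 , m′ ⟫ × Hit u f ⟪ 1 , m′ ⟫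

opaque
  reachᵣ : Rec {3} (λ xs → Reach (lookup xs 0F) (lookup xs 1F) (lookup xs 2F))
  reachᵣ = ∀<ᵣ (varᶜ 2F) (≤ᵣ (π₁ᶜ (varᶜ 0F)) (varᶜ 2F)
    ∨ᵣ at₃ᵣ hitᵣ (varᶜ 1F) (varᶜ 2F) (⟪⟫ᶜ (constᶜ 0) (varᶜ 0F))
    ∧ᵣ at₃ᵣ hitᵣ (varᶜ 1F) (varᶜ 2F) (⟪⟫ᶜ (constᶜ 1) (varᶜ 0F)))

-- The first k found such that the binary program e accepts the two programs of
-- the pair ⟪ e , k ⟫, shifted by one.

accepts : ℕ → ℕ → ℕ
accepts e w =
  ifz (U e ⟪ ⟪ 0 , ⟪ e , π₁ w ⟫ ⟫ , ⟪ ⟪ 1 , ⟪ e , π₁ w ⟫ ⟫ , 0 ⟫ ⟫ (π₂ w)) 0 (suc (π₁ w))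

selected : ℕ → ℕ → ℕ
selected u e = first (accepts e) u

selectedᶜ : Comp a → Comp b → Comp (λ xs → selected (a xs) (b xs))
selectedᶜ = lift₂ selected (firstᶜ (varᶜ 0F)
  (ifzᶜ (Uᶜ (varᶜ 2F) (⟪⟫ᶜ (⟪⟫ᶜ (constᶜ 0) eᶜ) (⟪⟫ᶜ (⟪⟫ᶜ (constᶜ 1) eᶜ) (constᶜ 0))) (π₂ᶜ (varᶜ 0F)))
    (constᶜ 0) (sucᶜ (π₁ᶜ (varᶜ 0F)))))
  where
  eᶜ : Comp {3} (λ xs → ⟪ lookup xs 2F , π₁ (lookup xs 0F) ⟫)
  eᶜ = ⟪⟫ᶜ (varᶜ 2F) (π₁ᶜ (varᶜ 0F))

-- Domain of program ⟪ b , m ⟫ of pair m, where b < 2.  The two programs differ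
-- at ⟪ f , 0 ⟫ iff f works on pair m forever, and at ⟪ _ , 1 ⟫ iff the pair is
-- selected; the points ⟪ _ , 2 + _ ⟫ make the domain infinite.

InPair : ℕ → ℕ → ℕ → ℕ → Set
InPair u b m x = (π₂ x ≡ 0 × Reach u (π₁ x) (b + m))
               ⊎ (π₂ x ≡ 1 × b ≡ 0 × selected u (π₁ m) ≡ suc (π₂ m))
               ⊎ 2 ≤ π₂ x

opaque
  inPairᵣ : Rec {4} (λ xs → InPair (lookup xs 0F) (lookup xs 1F) (lookup xs 2F) (lookup xs 3F))
  inPairᵣ = (≡ᵣ (π₂ᶜ (varᶜ 3F)) (constᶜ 0)
              ∧ᵣ at₃ᵣ reachᵣ (varᶜ 0F) (π₁ᶜ (varᶜ 3F)) (+ᶜ (varᶜ 1F) (varᶜ 2F)))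
          ∨ᵣ (≡ᵣ (π₂ᶜ (varᶜ 3F)) (constᶜ 1) ∧ᵣ ≡ᵣ (varᶜ 1F) (constᶜ 0)
              ∧ᵣ ≡ᵣ (selectedᶜ (varᶜ 0F) (π₁ᶜ (varᶜ 2F))) (sucᶜ (π₂ᶜ (varᶜ 2F))))
          ∨ᵣ ≤ᵣ (constᶜ 2) (π₂ᶜ (varᶜ 3F))

-- Both programs take only the value `m`, so one value of a function leaves a single pair that it
-- can belong to.
pairTab : ℕ → ℕ → ℕ → ℕ → ℕ
pairTab u b m x = guard (χ inPairᵣ (u ∷ b ∷ m ∷ x ∷ [])) (suc m)

pairTabᶜ : Comp a → Comp b → Comp c → Comp d →
           Comp (λ xs → pairTab (a xs) (b xs) (c xs) (d xs))
pairTabᶜ = lift₄ pairTab (guardᶜ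
  (at₄ (χᶜ inPairᵣ) (varᶜ 0F) (varᶜ 1F) (varᶜ 2F) (varᶜ 3F)) (sucᶜ (varᶜ 2F)))

-- Equal limits clash for all large `n`, different ones for boundedly many: `n ≤ u` makes a long
-- agreement a late one, by which time a difference has shown up. The bound `m < n` keeps the search
-- finite and excludes each pair only for small `n`.
Clash : ℕ → ℕ → ℕ → Set
Clash u i n = n ≤ u ×
  ((∃[ j ] j < i × (∀ x → x < n → evenTab u i x ≡ evenTab u j x)) ⊎
   (∃[ m ] m < n × (∃[ b ] b < 2 × (∀ x → x < n → evenTab u i x ≡ pairTab u b m x))))

opaque
  clashᵣ : Rec {3} (λ xs → Clash (lookup xs 0F) (lookup xs 1F) (lookup xs 2F))
  clashᵣ = ≤ᵣ (varᶜ 2F) (varᶜ 0F)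
    ∧ᵣ ( ∃<ᵣ (varᶜ 1F) (∀<ᵣ (varᶜ 3F)
           (≡ᵣ (evenTabᶜ (varᶜ 2F) (varᶜ 3F) (varᶜ 0F)) (evenTabᶜ (varᶜ 2F) (varᶜ 1F) (varᶜ 0F))))
       ∨ᵣ ∃<ᵣ (varᶜ 2F) (∃<ᵣ (constᶜ 2) (∀<ᵣ (varᶜ 4F)
           (≡ᵣ (evenTabᶜ (varᶜ 3F) (varᶜ 4F) (varᶜ 0F))
              (pairTabᶜ (varᶜ 3F) (varᶜ 1F) (varᶜ 2F) (varᶜ 0F))))))

-- Each n counts once, at the first stage at which it clashes.

Event : ℕ → ℕ → Set
Event i t = t ≡ 0 ⊎ Clash (π₂ t) i (π₁ t) × (∀ u → u < π₂ t → ¬ Clash u i (π₁ t))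

opaque
  eventᵣ : Rec {2} (λ xs → Event (lookup xs 0F) (lookup xs 1F))
  eventᵣ = ≡ᵣ (varᶜ 1F) (constᶜ 0)
    ∨ᵣ at₃ᵣ clashᵣ (π₂ᶜ (varᶜ 1F)) (varᶜ 0F) (π₁ᶜ (varᶜ 1F))
    ∧ᵣ ∀<ᵣ (π₂ᶜ (varᶜ 1F)) (¬ᵣ (at₃ᵣ clashᵣ (varᶜ 0F) (varᶜ 1F) (π₁ᶜ (varᶜ 2F))))

-- The candidate ⟪ 3 + i , s ⟫ follows evenTab i, in the hope that s is the last
-- event of i, and is frozen at the first stage t ≥ s refuting this.

Refuted : ℕ → ℕ → ℕ → Set
Refuted i s t = (t ≡ s × ¬ Event i s) ⊎ (s < t × Event i t)

opaque
  refutedᵣ : Rec {3} (λ xs → Refuted (lookup xs 0F) (lookup xs 1F) (lookup xs 2F))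
  refutedᵣ = (≡ᵣ (varᶜ 2F) (varᶜ 1F) ∧ᵣ ¬ᵣ (at₂ᵣ eventᵣ (varᶜ 0F) (varᶜ 1F)))
           ∨ᵣ (<ᵣ (varᶜ 1F) (varᶜ 2F) ∧ᵣ at₂ᵣ eventᵣ (varᶜ 0F) (varᶜ 2F))

freeze : ℕ → ℕ → ℕ → ℕ
freeze u i s = first (λ t → guard (χ refutedᵣ (i ∷ s ∷ t ∷ [])) (suc ⟪ i , t ⟫)) u

freezeᶜ : Comp a → Comp b → Comp c → Comp (λ xs → freeze (a xs) (b xs) (c xs))
freezeᶜ = lift₃ freeze (firstᶜ (varᶜ 0F)
  (guardᶜ (at₃ (χᶜ refutedᵣ) (varᶜ 2F) (varᶜ 3F) (varᶜ 0F)) (sucᶜ (⟪⟫ᶜ (varᶜ 2F) (varᶜ 0F)))))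

follow : ℕ → ℕ → ℕ → ℕ
follow 0       y x = y
follow (suc z) y x = frozenTab z x

followᶜ : Comp a → Comp b → Comp c → Comp (λ xs → follow (a xs) (b xs) (c xs))
followᶜ = lift₃ follow (caseᶜ (λ xs k → follow k (lookup xs 1F) (lookup xs 2F)) (varᶜ 0F) (varᶜ 1F)
  (frozenTabᶜ (varᶜ 0F) (varᶜ 3F)) λ _ _ → refl)

psi : ℕ → ℕ → ℕ → ℕ → ℕ
psi u 0                   r x = pairTab u 0 r x
psi u 1                   r x = pairTab u 1 r x
psi u 2                   r x = frozenTab r x
psi u (suc (suc (suc i))) r x = follow (freeze u i r) (evenTab u i x) x

psiᶜ : Comp a → Comp b → Comp c → Comp d → Comp (λ xs → psi (a xs) (b xs) (c xs) (d xs))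
psiᶜ = lift₄ psi
  (caseᶜ (λ xs t → psi (lookup xs 0F) t (lookup xs 2F) (lookup xs 3F)) (varᶜ 1F)
    (pairTabᶜ (varᶜ 0F) (constᶜ 0) (varᶜ 2F) (varᶜ 3F))
  (caseᶜ (λ xs t → psi (lookup xs 1F) (suc t) (lookup xs 3F) (lookup xs 4F)) (varᶜ 0F)
    (pairTabᶜ (varᶜ 1F) (constᶜ 1) (varᶜ 3F) (varᶜ 4F))
  (caseᶜ (λ xs t → psi (lookup xs 2F) (suc (suc t)) (lookup xs 4F) (lookup xs 5F)) (varᶜ 0F)
    (frozenTabᶜ (varᶜ 4F) (varᶜ 5F))
    (followᶜ (freezeᶜ (varᶜ 3F) (varᶜ 0F) (varᶜ 5F)) (evenTabᶜ (varᶜ 3F) (varᶜ 0F) (varᶜ 6F)) (varᶜ 6F))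
    (λ _ _ → refl))
    (λ _ _ → refl))
    (λ _ _ → refl))

Ψ : ℕ → ℕ → ℕ → ℕ
Ψ p u x = psi u (π₁ p) (π₂ p) x

Ψᶜ : Comp a → Comp b → Comp c → Comp (λ xs → Ψ (a xs) (b xs) (c xs))
Ψᶜ aᶜ bᶜ cᶜ = psiᶜ bᶜ (π₁ᶜ aᶜ) (π₂ᶜ aᶜ) cᶜ

frozenAt : ℕ → ℕ → ℕ → ℕ
frozenAt u 0                   r = 0
frozenAt u 1                   r = 0
frozenAt u 2                   r = suc r
frozenAt u (suc (suc (suc i))) r = freeze u i r

frozenAtᶜ : Comp a → Comp b → Comp c → Comp (λ xs → frozenAt (a xs) (b xs) (c xs))
frozenAtᶜ = lift₃ frozenAt
  (caseᶜ (λ xs t → frozenAt (lookup xs 0F) t (lookup xs 2F)) (varᶜ 1F) (constᶜ 0)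
  (caseᶜ (λ xs t → frozenAt (lookup xs 1F) (suc t) (lookup xs 3F)) (varᶜ 0F) (constᶜ 0)
  (caseᶜ (λ xs t → frozenAt (lookup xs 2F) (suc (suc t)) (lookup xs 4F)) (varᶜ 0F) (sucᶜ (varᶜ 4F))
    (freezeᶜ (varᶜ 3F) (varᶜ 0F) (varᶜ 5F)) (λ _ _ → refl)) (λ _ _ → refl)) (λ _ _ → refl))

-- Shifted by one; 0 as long as p is not known to compute a frozen table.

frozen : ℕ → ℕ → ℕ
frozen p u = frozenAt u (π₁ p) (π₂ p)

-- Monotone approximations

Monotone : (ℕ → ℕ → ℕ) → Set
Monotone h = ∀ {u v x y} → h u x ≡ suc y → u ≤ v → h v x ≡ suc y

Limit : (ℕ → ℕ → ℕ) → ℕ → ℕ → Set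
Limit h x y = ∃[ u ] h u x ≡ suc y

infix 3 _≐_

_≐_ : (G H : ℕ → ℕ → Set) → Set
G ≐ H = ∀ x y → G x y ⇔ H x y

≐-refl : ∀ {G} → G ≐ G
≐-refl x y = mk⇔ (λ g → g) (λ g → g)

≐-sym : ∀ {G H} → G ≐ H → H ≐ G
≐-sym e x y = mk⇔ (from (e x y)) (to (e x y))

≐-trans : ∀ {G H K} → G ≐ H → H ≐ K → G ≐ K
≐-trans e f x y = mk⇔ (to (f x y) ∘ to (e x y)) (from (e x y) ∘ from (f x y))

monotone-step : ∀ h → (∀ {u x y} → h u x ≡ suc y → h (suc u) x ≡ suc y) → Monotone h
monotone-step h st {v = 0}     e z≤n = e
monotone-step h st {v = suc v} e u≤v with m≤n⇒m<n∨m≡n u≤v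
... | inj₁ u<v  = st (monotone-step h st e (s≤s⁻¹ u<v))
... | inj₂ refl = e

limit-unique : ∀ h → Monotone h → ∀ {x y z} → Limit h x y → Limit h x z → y ≡ z
limit-unique h mono {x} {y} {z} (u , p) (v , q) =
  suc-injective (trans (sym (mono p (m≤m⊔n u v))) (mono q (m≤n⊔m u v)))

suc-≡ : ∀ {a b : ℕ} → (∀ y → a ≡ suc y ⇔ b ≡ suc y) → a ≡ b
suc-≡ {0}     {0}     e = refl
suc-≡ {0}     {suc b} e = from (e b) refl
suc-≡ {suc a} {b}     e = sym (to (e a) refl)

-- Parity of finite domains, monotonicity of the tables

parity-ext : ∀ {d d′} n → (∀ x → x < n → d x ≡ d′ x) → parity d n ≡ parity d′ n
parity-ext 0       e = refl
parity-ext {d} {d′} (suc n) e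
  rewrite e n ≤-refl | parity-ext {d} {d′} n (λ x x<n → e x (m<n⇒m<1+n x<n)) = refl

parity-beyond : ∀ d {n m} → (∀ x → n ≤ x → d x ≡ 0) → n ≤ m → parity d m ≡ parity d n
parity-beyond d {m = 0}     e z≤n = refl
parity-beyond d {n} {suc m} e n≤m with m≤n⇒m<n∨m≡n n≤m
... | inj₂ refl = refl
... | inj₁ n<m rewrite e m (s≤s⁻¹ n<m) = parity-beyond d e (s≤s⁻¹ n<m)

parity-bit : ∀ d n → parity d n ≡ 0 ⊎ parity d n ≡ 1
parity-bit d 0 = inj₁ refl
parity-bit d (suc n) with d n | parity d n | parity-bit d n
... | 0     | _ | h         = h
... | suc _ | _ | inj₁ refl = inj₂ refl
... | suc _ | _ | inj₂ refl = inj₁ refl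

parity-flip : ∀ {d d′ x₀ y n} → x₀ < n → d x₀ ≡ 0 → d′ x₀ ≡ suc y → (∀ x → x ≢ x₀ → d x ≡ d′ x) →
              parity d′ n ≡ 1 ∸ parity d n
parity-flip {d} {d′} {x₀} {n = suc n} x₀<n e e′ same with m<1+n⇒m<n∨m≡n x₀<n
... | inj₂ refl rewrite e | e′ = cong (1 ∸_) (parity-ext n λ x x<n → sym (same x (<⇒≢ x<n)))
... | inj₁ x₀<n with ih ← parity-flip {d} {d′} {n = n} x₀<n e e′ same
                   | eq ← same n (λ n≡x₀ → <⇒≢ x₀<n (sym n≡x₀)) rewrite eq | ih with d′ n
...   | 0     = refl
...   | suc _ = refl

Odd : (ℕ → ℕ → Set) → Set
Odd G = Σ (ℕ → ℕ) λ d → ∃[ n ] (∀ x y → G x y ⇔ d x ≡ suc y) × (∀ x → n ≤ x → d x ≡ 0) × parity d n ≡ 1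

Odd-resp : ∀ {G H} → G ≐ H → Odd G → Odd H
Odd-resp e (d , n , g , h) =
  d , n , (λ x y → mk⇔ (to (g x y) ∘ from (e x y)) (to (e x y) ∘ from (g x y))) , h

U-det : ∀ {i E k l y z} → U i E k ≡ suc y → U i E l ≡ suc z → y ≡ z
U-det {i} {E} {k} {l} p q =
  suc-injective (trans (sym (U-mono i E p (m≤m⊔n k l))) (U-mono i E q (m≤n⊔m k l)))

tab-mono : ∀ i → Monotone (λ s → tab s i)
tab-mono i {u} {v} {x} = first-mono (entry i x) {u} {v}

tab-sound : ∀ {s i x y} → tab s i x ≡ suc y → ∃[ k ] U i ⟪ x , 0 ⟫ k ≡ suc y
tab-sound {s} {i} {x} e with w , _ , g , _ ← first-sound (entry i x) {s} e =
  π₂ w , proj₂ (guard-suc sameᵣ {π₁ w ∷ x ∷ []} g)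

tab-bound : ∀ {s i x y} → tab s i x ≡ suc y → x < s
tab-bound {s} {i} {x} e with w , w<s , g , _ ← first-sound (entry i x) {s} e
  with refl , _ ← guard-suc sameᵣ {π₁ w ∷ x ∷ []} g = ≤-<-trans (π₁-≤ w) w<s

tab-beyond : ∀ s i x → s ≤ x → tab s i x ≡ 0
tab-beyond s i x s≤x with tab s i x in eq
... | 0     = refl
... | suc _ = contradiction (<-≤-trans (tab-bound {s} eq) s≤x) (<-irrefl refl)

tab-complete : ∀ {i x k y} → U i ⟪ x , 0 ⟫ k ≡ suc y → ∃[ s ] tab s i x ≡ suc y
tab-complete {i} {x} {k} {y} e = suc w , trans eq (cong suc (U-det {i} (proj₂ (tab-sound {suc w} eq)) e))
  where
  w = ⟪ x , k ⟫
  found : entry i x w ≡ suc y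
  found = trans (guard-yes sameᵣ {π₁ w ∷ x ∷ []} (π₁-⟪⟫ x k)) (trans (cong (U i ⟪ x , 0 ⟫) (π₂-⟪⟫ x k)) e)
  eq = proj₂ (first-compl (entry i x) found ≤-refl)

tab-step : ∀ s i x → x ≢ π₁ s → tab s i x ≡ tab (suc s) i x
tab-step s i x x≢ with tab s i x
... | suc _ = refl
... | 0 with entry i x s in eq
...   | 0     = refl
...   | suc _ = contradiction (sym (proj₁ (guard-suc sameᵣ {π₁ s ∷ x ∷ []} eq))) x≢

-- At most one point enters per stage, and it changes the parity of the size.

tab-frozen : ∀ {i s₀} → (∀ s → s₀ ≤ s → size s i ≡ 1) → ∀ {s x y} → tab s i x ≡ suc y → tab s₀ i x ≡ suc y
tab-frozen {i} {s₀} odd {s} e with ≤-total s s₀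
... | inj₁ s≤s₀ = tab-mono i e s≤s₀
... | inj₂ s₀≤s = go s s₀≤s e
  where
  go : ∀ s → s₀ ≤ s → ∀ {x y} → tab s i x ≡ suc y → tab s₀ i x ≡ suc y
  go s s₀≤s e with m≤n⇒m<n∨m≡n s₀≤s
  go s       s₀≤s e | inj₂ refl = e
  go (suc s) _ {x} {y} e | inj₁ s₀<s with tab s i x in eq
  ... | suc _ = go s (s≤s⁻¹ s₀<s) (trans eq e)
  ... | 0     = contradiction (trans (sym (odd (suc s) (<⇒≤ s₀<s))) flipped) 1+n≢0
    where
    x≡ : x ≡ π₁ s
    x≡ = sym (proj₁ (guard-suc sameᵣ {π₁ s ∷ x ∷ []} e))
    new : tab (suc s) i x ≡ suc y
    new = trans (cong (λ a → orElse a (entry i x s)) eq) e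
    flipped : size (suc s) i ≡ 0
    flipped = trans (parity-flip (s≤s (≤-trans (≤-reflexive x≡) (π₁-≤ s))) eq new
                       (λ x′ x′≢x → tab-step s i x′ (λ x′≡ → x′≢x (trans x′≡ (sym x≡)))))
      (cong (1 ∸_) (trans (parity-beyond (tab s i) (tab-beyond s i) (n≤1+n s)) (odd s (s≤s⁻¹ s₀<s))))

evenTab-sub : ∀ s {i x y} → evenTab s i x ≡ suc y → tab s i x ≡ suc y
evenTab-sub (suc s) {i} e with size (suc s) i
... | 0     = e
... | suc _ = tab-mono i (evenTab-sub s e) (n≤1+n s)

evenTab-mono : ∀ i → Monotone (λ s → evenTab s i)
evenTab-mono i = monotone-step (λ s → evenTab s i) λ {s} → st s
  where
  st : ∀ s {x y} → evenTab s i x ≡ suc y → evenTab (suc s) i x ≡ suc y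
  st s e with size (suc s) i
  ... | 0     = tab-mono i (evenTab-sub s e) (n≤1+n s)
  ... | suc _ = e

evenTab-now : ∀ s {i} → size s i ≡ 0 → ∀ x → evenTab s i x ≡ tab s i x
evenTab-now 0       e x = refl
evenTab-now (suc s) e x rewrite e = refl

evenTab-origin : ∀ s i → ∃[ r ] size r i ≡ 0 × (∀ x → evenTab s i x ≡ tab r i x)
evenTab-origin 0 i = 0 , refl , λ _ → refl
evenTab-origin (suc s) i with size (suc s) i in eq
... | 0     = suc s , eq , λ _ → refl
... | suc _ = evenTab-origin s i

collect : ∀ h → Monotone h → ∀ (d : ℕ → ℕ) n → (∀ x y → d x ≡ suc y → Limit h x y) →
          ∃[ u ] (∀ x y → x < n → d x ≡ suc y → h u x ≡ suc y)
collect h mono d 0 lim = 0 , λ _ _ ()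
collect h mono d (suc n) lim with u , all ← collect h mono d n lim with d n in eq
... | 0 = u , λ x y x<1+n e → [ (λ x<n → all x y x<n e)
                              , (λ { refl → contradiction (trans (sym eq) e) 0≢1+n }) ]′
                              (m<1+n⇒m<n∨m≡n x<1+n)
... | suc y₀ with v , hv ← lim n y₀ eq =
  u ⊔ v , λ x y x<1+n e → [ (λ x<n → mono (all x y x<n e) (m≤m⊔n u v))
                          , (λ { refl → trans (mono hv (m≤n⊔m u v)) (trans (sym eq) e) }) ]′
                            (m<1+n⇒m<n∨m≡n x<1+n)

-- A finite limit is complete at some stage `u`, and by `evenTab-origin` the table shown then is a
-- stage of even size.
even-¬odd : ∀ i → ¬ Odd (Limit (λ s → evenTab s i))
even-¬odd i (d , n , g , beyond , odd)
  with u , all ← collect (λ s → evenTab s i) (evenTab-mono i) d n (λ x y → from (g x y))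
  with r , even , origin ← evenTab-origin u i
  = contradiction (trans (sym odd) parity≡0) 1+n≢0
  where
  inside : ∀ {x y} → d x ≡ suc y → x < n
  inside {x} e = ≰⇒> λ n≤x → 0≢1+n (trans (sym (beyond x n≤x)) e)
  d≡tab : ∀ x → d x ≡ tab r i x
  d≡tab x = suc-≡ λ y → mk⇔ (λ e → trans (sym (origin x)) (all x y (inside e) e))
                             (λ e → to (g x y) (u , trans (origin x) e))
  parity≡0 : parity d n ≡ 0
  parity≡0 = trans (sym (parity-beyond d beyond (m≤m⊔n n r)))
    (trans (parity-ext (n ⊔ r) (λ x _ → d≡tab x))
      (trans (parity-beyond (tab r i) (tab-beyond r i) (m≤n⊔m n r)) even))

frozenTab-⊇ : ∀ i t {x y} → tab t i x ≡ suc y → frozenTab ⟪ i , t ⟫ x ≡ suc y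
frozenTab-⊇ i t e rewrite π₁-⟪⟫ i t | π₂-⟪⟫ i t | e = refl

orElse-identityʳ : ∀ x → orElse x 0 ≡ x
orElse-identityʳ 0       = refl
orElse-identityʳ (suc x) = refl

frozenTab-other : ∀ z x → x ≢ π₂ z → frozenTab z x ≡ tab (π₂ z) (π₁ z) x
frozenTab-other z x x≢t with size (π₂ z) (π₁ z)
... | suc _ = orElse-identityʳ _
... | 0 with χ sameᵣ (x ∷ π₂ z ∷ []) in eq
...   | 0     = contradiction (sound sameᵣ (x ∷ π₂ z ∷ []) eq) x≢t
...   | suc _ = orElse-identityʳ _

frozenTab-beyond : ∀ z x → π₂ z < x → frozenTab z x ≡ 0
frozenTab-beyond z x t<x =
  trans (frozenTab-other z x (λ x≡t → <⇒≢ t<x (sym x≡t))) (tab-beyond (π₂ z) (π₁ z) x (<⇒≤ t<x))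

frozenTab-odd : ∀ z → Odd (Limit (λ _ → frozenTab z))
frozenTab-odd z = frozenTab z , suc t , (λ x y → mk⇔ proj₂ (0 ,_)) , frozenTab-beyond z , odd
  where
  i = π₁ z
  t = π₂ z
  below : parity (frozenTab z) t ≡ size t i
  below = parity-ext t λ x x<t → frozenTab-other z x (<⇒≢ x<t)
  odd : parity (frozenTab z) (suc t) ≡ 1
  odd with parity-bit (tab t i) t
  -- The extra point `t` is new, by `tab-beyond`, and so it does change the parity.
  ... | inj₁ even
    rewrite below | even | tab-beyond t i t ≤-refl | guard-yes sameᵣ {t ∷ t ∷ []} {1} refl = refl
  ... | inj₂ odd  rewrite below | odd  | tab-beyond t i t ≤-refl = refl

frozenTab-now : ∀ i t → size t i ≡ 1 → ∀ x → frozenTab ⟪ i , t ⟫ x ≡ tab t i x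
frozenTab-now i t odd x rewrite π₁-⟪⟫ i t | π₂-⟪⟫ i t | odd = orElse-identityʳ _

Hit-mono : ∀ {u v f q} → u ≤ v → Hit u f q → Hit v f q
Hit-mono {f = f} u≤v (n , n<u , e) = n , <-≤-trans n<u u≤v , tab-mono f e u≤v

Reach-mono : ∀ {u v f m} → u ≤ v → Reach u f m → Reach v f m
Reach-mono u≤v r m′ m′<m with r m′ m′<m
... | inj₁ le      = inj₁ le
... | inj₂ (p , q) = inj₂ (Hit-mono u≤v p , Hit-mono u≤v q)

InPair-mono : ∀ {u v b m x} → u ≤ v → InPair u b m x → InPair v b m x
InPair-mono u≤v (inj₁ (e , r)) = inj₁ (e , Reach-mono u≤v r)
InPair-mono {m = m} u≤v (inj₂ (inj₁ (e , b≡0 , s))) =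
  inj₂ (inj₁ (e , b≡0 , first-mono (accepts (π₁ m)) s u≤v))
InPair-mono u≤v (inj₂ (inj₂ le)) = inj₂ (inj₂ le)

pairTab-yes : ∀ {u b m x} → InPair u b m x → pairTab u b m x ≡ suc m
pairTab-yes {u} {b} {m} {x} = guard-yes inPairᵣ {u ∷ b ∷ m ∷ x ∷ []}

pairTab-suc : ∀ {u b m x y} → pairTab u b m x ≡ suc y → InPair u b m x × m ≡ y
pairTab-suc {u} {b} {m} {x} e with p , refl ← guard-suc inPairᵣ {u ∷ b ∷ m ∷ x ∷ []} e = p , refl

pairTab-mono : ∀ b m → Monotone (λ u → pairTab u b m)
pairTab-mono b m {u} {v} {x} e u≤v with p , refl ← pairTab-suc {u} {b} {m} {x} e =
  pairTab-yes (InPair-mono u≤v p)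

pairTab-always : ∀ u b m x → pairTab u b m ⟪ x , 2 ⟫ ≡ suc m
pairTab-always u b m x = pairTab-yes {u} {b} {m} (inj₂ (inj₂ (≤-reflexive (sym (π₂-⟪⟫ x 2)))))

pair-¬odd : ∀ b m → ¬ Odd (Limit (λ u → pairTab u b m))
pair-¬odd b m (d , n , g , beyond , _) = 0≢1+n (trans (sym (beyond ⟪ n , 2 ⟫ (m≤⟪m,n⟫ n 2)))
  (to (g ⟪ n , 2 ⟫ m) (0 , pairTab-always 0 b m n)))

freeze-suc : ∀ {u i s z} → freeze u i s ≡ suc z →
             ∃[ t ] t < u × z ≡ ⟪ i , t ⟫ × Refuted i s t
freeze-suc {u} {i} {s} e
  with t , t<u , g , _ ← first-sound (λ t → guard (χ refutedᵣ (i ∷ s ∷ t ∷ [])) (suc ⟪ i , t ⟫)) {u} e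
  with r , refl ← guard-suc refutedᵣ {i ∷ s ∷ t ∷ []} g = t , t<u , refl , r

freeze-mono : ∀ {u v i s z} → freeze u i s ≡ suc z → u ≤ v → freeze v i s ≡ suc z
freeze-mono = first-mono _

freeze-refuted : ∀ {u i s t} → Refuted i s t → t < u → ∃[ z ] freeze u i s ≡ suc z
freeze-refuted {i = i} {s} {t} r t<u =
  first-compl (λ t → guard (χ refutedᵣ (i ∷ s ∷ t ∷ [])) (suc ⟪ i , t ⟫))
    (guard-yes refutedᵣ {i ∷ s ∷ t ∷ []} r) t<u

candidate-mono : ∀ i s → Monotone (λ u x → follow (freeze u i s) (evenTab u i x) x)
candidate-mono i s {u} {v} e u≤v with freeze u i s in equ
... | suc z rewrite freeze-mono {u} {v} {i} {s} equ u≤v = e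
... | 0 with freeze v i s in eqv
...   | 0     = evenTab-mono i e u≤v
...   | suc z with t , _ , refl , r ← freeze-suc {v} {i} {s} eqv =
  frozenTab-⊇ i t (evenTab-sub t (evenTab-mono i e (≮⇒≥ λ t<u →
    0≢1+n (trans (sym equ) (proj₂ (freeze-refuted {u} r t<u))))))

psi-mono : ∀ t r → Monotone (λ u → psi u t r)
psi-mono 0                   r = pairTab-mono 0 r
psi-mono 1                   r = pairTab-mono 1 r
psi-mono 2                   r = λ e _ → e
psi-mono (suc (suc (suc i))) r = candidate-mono i r

Graph : ℕ → ℕ → ℕ → Set
Graph p = Limit (Ψ p)

Ψ-mono : ∀ p → Monotone (Ψ p)
Ψ-mono p = psi-mono (π₁ p) (π₂ p)

-- Equalities between programs

module Classical (em : ExcludedMiddle 0ℓ) where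

  settled : ∀ h h′ → Monotone h → Monotone h′ → Limit h ≐ Limit h′ →
            ∀ x → ∃[ v ] (∀ u → v ≤ u → h u x ≡ h′ u x)
  settled h h′ mono mono′ e x with em {∃ (Limit h x)}
  ... | yes (y , v , p) with w , q ← to (e x y) (v , p) =
    v ⊔ w , λ u le → trans (mono p (m⊔n≤o⇒m≤o v w le)) (sym (mono′ q (m⊔n≤o⇒n≤o v w le)))
  ... | no ¬lim = 0 , λ u _ → suc-≡ λ y →
    mk⇔ (λ p → contradiction (y , u , p) ¬lim)
        (λ q → contradiction (y , from (e x y) (u , q)) ¬lim)

  agree : ∀ h h′ → Monotone h → Monotone h′ → Limit h ≐ Limit h′ →
          ∀ n → ∃[ u₀ ] (∀ u → u₀ ≤ u → ∀ x → x < n → h u x ≡ h′ u x)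
  agree h h′ mono mono′ e 0 = 0 , λ _ _ _ ()
  agree h h′ mono mono′ e (suc n) with u₀ , same ← agree h h′ mono mono′ e n
                                  with v₀ , same′ ← settled h h′ mono mono′ e n =
    u₀ ⊔ v₀ , λ u le x x<1+n → [ same u (m⊔n≤o⇒m≤o u₀ v₀ le) x
                               , (λ { refl → same′ u (m⊔n≤o⇒n≤o u₀ v₀ le) }) ]′ (m<1+n⇒m<n∨m≡n x<1+n)

  -- A point in just one of the limits has appeared there by some stage `v` and never appears in the
  -- other. Once `n` exceeds both the point and `v`, an agreement below `n` at a stage `u ≥ n` is
  -- impossible.
  differ : ∀ h h′ → Monotone h → Monotone h′ → ¬ (Limit h ≐ Limit h′) →
           ∃[ N ] (∀ n u → n ≤ u → (∀ x → x < n → h u x ≡ h′ u x) → n < N)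
  differ h h′ mono mono′ ≄ with em {∃[ x ] ∃[ y ] (Limit h x y × ¬ Limit h′ x y)}
                             | em {∃[ x ] ∃[ y ] (Limit h′ x y × ¬ Limit h x y)}
  ... | yes (x , y , (v , p) , ¬q) | _ = suc (x ⊔ v) , λ n u n≤u same → s≤s (≮⇒≥ λ lt →
    ¬q (u , trans (sym (same x (≤-<-trans (m≤m⊔n x v) lt)))
                  (mono p (≤-trans (m≤n⊔m x v) (≤-trans (<⇒≤ lt) n≤u)))))
  ... | no _ | yes (x , y , (v , p) , ¬q) = suc (x ⊔ v) , λ n u n≤u same → s≤s (≮⇒≥ λ lt →
    ¬q (u , trans (same x (≤-<-trans (m≤m⊔n x v) lt))
                  (mono′ p (≤-trans (m≤n⊔m x v) (≤-trans (<⇒≤ lt) n≤u)))))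
  ... | no ¬a | no ¬b = contradiction (λ x y → mk⇔
    (λ p → [ (λ q → q) , (λ ¬q → contradiction (x , y , p , ¬q) ¬a) ]′ (decide _))
    (λ p → [ (λ q → q) , (λ ¬q → contradiction (x , y , p , ¬q) ¬b) ]′ (decide _))) ≄
    where
    decide : (A : Set) → A ⊎ ¬ A
    decide A with em {A}
    ... | yes p = inj₁ p
    ... | no ¬p = inj₂ ¬p

  bounded : ∀ (P : ℕ → ℕ → Set) N → (∀ n → n < N → ∃[ b ] (∀ t → P n t → t < b)) →
            ∃[ b ] (∀ n t → n < N → P n t → t < b)
  bounded P 0       h = 0 , λ _ _ ()
  bounded P (suc N) h with b , below ← bounded P N (λ n n<N → h n (m<n⇒m<1+n n<N))
                      with b′ , below′ ← h N ≤-refl =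
    b ⊔ b′ , λ n t n<1+N p →
      [ (λ n<N → <-≤-trans (below n t n<N p) (m≤m⊔n b b′))
      , (λ { refl → <-≤-trans (below′ t p) (m≤n⊔m b b′) }) ]′ (m<1+n⇒m<n∨m≡n n<1+N)

  bounded-unique : (P : ℕ → Set) → (∀ {t t′} → P t → P t′ → t ≡ t′) → ∃[ b ] (∀ t → P t → t < b)
  bounded-unique P unique with em {∃ P}
  ... | yes (t , p) = suc t , λ t′ p′ → ≤-reflexive (cong suc (unique p′ p))
  ... | no ¬p       = 0 , λ t p → contradiction (t , p) ¬p

  least-below : (P : ℕ → Set) → ∀ N → (∃[ n ] P n × (∀ m → m < n → ¬ P m)) ⊎ (∀ m → m < N → ¬ P m)
  least-below P 0 = inj₂ λ _ ()
  least-below P (suc N) with least-below P N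
  ... | inj₁ found = inj₁ found
  ... | inj₂ none with em {P N}
  ...   | yes p = inj₁ (N , p , none)
  ...   | no ¬p = inj₂ λ m m<1+N → [ none m , (λ { refl → ¬p }) ]′ (m<1+n⇒m<n∨m≡n m<1+N)

  least : (P : ℕ → Set) → ∃ P → ∃[ n ] P n × (∀ m → m < n → ¬ P m)
  least P (n , p) with least-below P (suc n)
  ... | inj₁ found = found
  ... | inj₂ none  = contradiction p (none n ≤-refl)

  last : (P : ℕ → Set) → P 0 → ∀ B → (∀ t → P t → t < B) → ∃[ s ] P s × (∀ t → s < t → ¬ P t)
  last P p₀ 0       below = contradiction (below 0 p₀) λ ()
  last P p₀ (suc B) below with em {P B}
  ... | yes p = B , p , λ t B<t q → <-irrefl refl (<-≤-trans B<t (s≤s⁻¹ (below t q)))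
  ... | no ¬p = last P p₀ B λ t q → ≤∧≢⇒< (s≤s⁻¹ (below t q)) λ { refl → ¬p q }

  Even : ℕ → ℕ → ℕ → Set
  Even i = Limit (λ u → evenTab u i)

  Pair : ℕ → ℕ → ℕ → ℕ → Set
  Pair b m = Limit (λ u → pairTab u b m)

  Table : ℕ → ℕ → ℕ → Set
  Table z = Limit (λ _ → frozenTab z)

  Event-⟪⟫ : ∀ {i n u} → Clash u i n → (∀ u′ → u′ < u → ¬ Clash u′ i n) → Event i ⟪ n , u ⟫
  Event-⟪⟫ {i} {n} {u} c first = inj₂
    ( subst₂ (λ u n → Clash u i n) (sym (π₂-⟪⟫ n u)) (sym (π₁-⟪⟫ n u)) c
    , λ u′ lt → subst (λ n → ¬ Clash u′ i n) (sym (π₁-⟪⟫ n u)) (first u′ (subst (u′ <_) (π₂-⟪⟫ n u) lt)))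

  -- The first clash of `n` happens at a stage `u` coded as `⟪ n , u ⟫`, which is at least `n`;
  -- large `n` therefore give late events.
  clashes⇒events : ∀ i N → (∀ n → N ≤ n → ∃[ u ] Clash u i n) → ∀ s → ∃[ t ] s < t × Event i t
  clashes⇒events i N clash s with u , c , first ← least _ (clash (suc s ⊔ N) (m≤n⊔m (suc s) N)) =
    ⟪ suc s ⊔ N , u ⟫ , ≤-trans (m≤m⊔n (suc s) N) (m≤⟪m,n⟫ _ u) , Event-⟪⟫ {i} c first

  even⇒events : ∀ {i j} → j < i → Even i ≐ Even j → ∀ s → ∃[ t ] s < t × Event i t
  even⇒events {i} {j} j<i e = clashes⇒events i 0 λ n _ → clash n
    where
    clash : ∀ n → ∃[ u ] Clash u i n
    clash n
      with u , same ← agree (λ u → evenTab u i) (λ u → evenTab u j)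
                            (evenTab-mono i) (evenTab-mono j) e n =
      n ⊔ u , m≤m⊔n n u , inj₁ (j , j<i , same (n ⊔ u) (m≤n⊔m n u))

  pair⇒events : ∀ {i b m} → b < 2 → Even i ≐ Pair b m → ∀ s → ∃[ t ] s < t × Event i t
  pair⇒events {i} {b} {m} b<2 e = clashes⇒events i (suc m) clash
    where
    clash : ∀ n → m < n → ∃[ u ] Clash u i n
    clash n m<n
      with u , same ← agree (λ u → evenTab u i) (λ u → pairTab u b m)
                            (evenTab-mono i) (pairTab-mono b m) e n =
      n ⊔ u , m≤m⊔n n u , inj₂ (m , m<n , b , b<2 , same (n ⊔ u) (m≤n⊔m n u))

  few-clashes : ∀ i → (∀ j → j < i → ¬ (Even i ≐ Even j)) → (∀ b m → b < 2 → ¬ (Even i ≐ Pair b m)) →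
                ∃[ N ] (∀ n u → Clash u i n → n < N)
  few-clashes i ≄even ≄pair = N₁ ⊔ proj₁ pairs , bound
    where
    evens : ∃[ N ] (∀ j n → j < i →
              (∃[ u ] n ≤ u × (∀ x → x < n → evenTab u i x ≡ evenTab u j x)) → n < N)
    evens = bounded _ i λ j j<i →
      let N , below = differ (λ u → evenTab u i) (λ u → evenTab u j)
                             (evenTab-mono i) (evenTab-mono j) (≄even j j<i)
      in N , λ n (u , n≤u , same) → below n u n≤u same
    N₁ = proj₁ evens
    -- A point at which every program of every pair is defined from the start.
    x₀ = ⟪ 0 , 2 ⟫
    Clashing : ℕ → ℕ → Set
    Clashing n u = ∃[ m ] ∃[ b ] b < 2 × (∀ x → x < n → evenTab u i x ≡ pairTab u b m x)
    -- The value at x₀ leaves only one pair to compare with.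
    pairs : ∃[ N ] (∀ n u → n ≤ u → Clashing n u → n < N)
    pairs with em {∃ (Even i x₀)}
    ... | no undefined = suc x₀ , λ n u n≤u (m , b , _ , same) → s≤s (≮⇒≥ λ x₀<n →
            undefined (m , u , trans (same x₀ x₀<n) (pairTab-always u b m 0)))
    ... | yes (y , v , p) = suc (x₀ ⊔ v) ⊔ proj₁ same-value , below
      where
      same-value : ∃[ N ] (∀ b n → b < 2 →
                     (∃[ u ] n ≤ u × (∀ x → x < n → evenTab u i x ≡ pairTab u b y x)) → n < N)
      same-value = bounded _ 2 λ b b<2 →
        let N , below = differ (λ u → evenTab u i) (λ u → pairTab u b y)
                               (evenTab-mono i) (pairTab-mono b y) (≄pair b y b<2)
        in N , λ n (u , n≤u , same) → below n u n≤u same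
      below : ∀ n u → n ≤ u → Clashing n u → n < suc (x₀ ⊔ v) ⊔ proj₁ same-value
      below n u n≤u (m , b , b<2 , same) with <-≤-connex (x₀ ⊔ v) n
      ... | inj₂ n≤ = <-≤-trans (s≤s n≤) (m≤m⊔n _ (proj₁ same-value))
      ... | inj₁ lt with refl ← suc-injective (trans (sym (pairTab-always u b m 0))
                                (trans (sym (same x₀ (≤-<-trans (m≤m⊔n x₀ v) lt)))
                                  (evenTab-mono i p (≤-trans (m≤n⊔m x₀ v) (≤-trans (<⇒≤ lt) n≤u))))) =
        <-≤-trans (proj₂ same-value b n b<2 (u , n≤u , same)) (m≤n⊔m (suc (x₀ ⊔ v)) _)
    bound : ∀ n u → Clash u i n → n < N₁ ⊔ proj₁ pairs
    bound n u (n≤u , inj₁ (j , j<i , same)) =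
      <-≤-trans (proj₂ evens j n j<i (u , n≤u , same)) (m≤m⊔n N₁ _)
    bound n u (n≤u , inj₂ (m , _ , b , b<2 , same)) =
      <-≤-trans (proj₂ pairs n u n≤u (m , b , b<2 , same)) (m≤n⊔m N₁ _)

  -- One `n` may clash at infinitely many stages, but only its first clash is an event, so a bound
  -- on `n` bounds the events.
  few-events : ∀ {i} → ∃[ N ] (∀ n u → Clash u i n → n < N) → ∃[ B ] (∀ t → Event i t → t < B)
  few-events {i} (N , few) = suc B , λ { t (inj₁ refl) → z<s
    ; t (inj₂ e) → m<n⇒m<1+n (below (π₁ t) t (few (π₁ t) (π₂ t) (proj₁ e)) (e , refl)) }
    where
    First : ℕ → ℕ → Set
    First n t = (Clash (π₂ t) i (π₁ t) × (∀ u → u < π₂ t → ¬ Clash u i (π₁ t))) × π₁ t ≡ n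
    unique : ∀ n {t t′} → First n t → First n t′ → t ≡ t′
    unique n {t} {t′} ((c , least) , e) ((c′ , least′) , e′) with <-cmp (π₂ t) (π₂ t′)
    ... | tri≈ _ eq _ = trans (⟪⟫-unique e eq) (sym (⟪⟫-unique e′ refl))
    ... | tri< lt _ _ = contradiction (subst (Clash (π₂ t) i) (trans e (sym e′)) c) (least′ _ lt)
    ... | tri> _ _ gt = contradiction (subst (Clash (π₂ t′) i) (trans e′ (sym e)) c′) (least _ gt)
    B×below = bounded First N λ n _ → bounded-unique (First n) (unique n)
    B = proj₁ B×below
    below = proj₂ B×below

  Alive : ℕ → ℕ → Set
  Alive i s = Event i s × (∀ t → s < t → ¬ Event i t)

  alive⇒unfrozen : ∀ {i s} → Alive i s → ∀ u → freeze u i s ≡ 0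
  alive⇒unfrozen {i} {s} (ev , none) u with freeze u i s in eq
  ... | 0     = refl
  ... | suc z with freeze-suc {u} {i} {s} eq
  ...   | _ , _ , _ , inj₁ (_ , ¬ev) = contradiction ev ¬ev
  ...   | t , _ , _ , inj₂ (s<t , e) = contradiction e (none t s<t)

  data Kind (p : ℕ) : Set where
    pair  : ∀ b m → b < 2 → p ≡ ⟪ b , m ⟫ → Kind p
    table : ∀ z u → frozen p u ≡ suc z → Kind p
    alive : ∀ i s → p ≡ ⟪ 3 + i , s ⟫ → Alive i s → Kind p

  kind : ∀ p → Kind p
  kind p with π₁ p in eq
  ... | 0 = pair 0 (π₂ p) z<s (⟪⟫-unique eq refl)
  ... | 1 = pair 1 (π₂ p) (s<s z<s) (⟪⟫-unique eq refl)
  ... | 2 = table (π₂ p) 0 (cong (λ t → frozenAt 0 t (π₂ p)) eq)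
  ... | suc (suc (suc i)) with em {∃[ u ] ∃[ z ] freeze u i (π₂ p) ≡ suc z}
  ...   | yes (u , z , e) = table z u (trans (cong (λ t → frozenAt u t (π₂ p)) eq) e)
  ...   | no never = alive i (π₂ p) (⟪⟫-unique eq refl) (event , λ t s<t ev →
            never (_ , freeze-refuted {suc t} {i} {π₂ p} (inj₂ (s<t , ev)) ≤-refl))
    where
    event : Event i (π₂ p)
    event with em {Event i (π₂ p)}
    ... | yes ev = ev
    ... | no ¬ev =
      contradiction (_ , freeze-refuted {suc (π₂ p)} {i} {π₂ p} (inj₁ (refl , ¬ev)) ≤-refl) never

  graph-⟪⟫ : ∀ t r → Graph ⟪ t , r ⟫ ≐ Limit (λ u → psi u t r)
  graph-⟪⟫ t r x y = mk⇔
    (λ (u , e) → u , trans (cong₂ (λ t r → psi u t r x) (sym (π₁-⟪⟫ t r)) (sym (π₂-⟪⟫ t r))) e)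
    (λ (u , e) → u , trans (cong₂ (λ t r → psi u t r x) (π₁-⟪⟫ t r) (π₂-⟪⟫ t r)) e)

  graph-pair : ∀ {b m} → b < 2 → Graph ⟪ b , m ⟫ ≐ Pair b m
  graph-pair {0}           {m} _ = graph-⟪⟫ 0 m
  graph-pair {1}           {m} _ = graph-⟪⟫ 1 m
  graph-pair {suc (suc _)} (s<s (s<s ()))

  graph-alive : ∀ {i s} → Alive i s → Graph ⟪ 3 + i , s ⟫ ≐ Even i
  graph-alive {i} {s} al = ≐-trans (graph-⟪⟫ (3 + i) s) λ x y →
    mk⇔ (λ (u , e) → u , trans (sym (eq u x)) e) (λ (u , e) → u , trans (eq u x) e)
    where
    eq : ∀ u x → psi u (3 + i) s x ≡ evenTab u i x
    eq u x rewrite alive⇒unfrozen {i} {s} al u = refl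

  graph-table : ∀ {p u z} → frozen p u ≡ suc z → Graph p ≐ Table z
  graph-table {p} {u} {z} e = go (π₁ p) e
    where
    go : ∀ t → frozenAt u t (π₂ p) ≡ suc z → Limit (λ u → psi u t (π₂ p)) ≐ Table z
    go 2 refl x y = mk⇔ (λ g → g) (λ g → g)
    go (suc (suc (suc i))) e x y = mk⇔
      (λ (v , g) → 0 , trans (sym (later (u ⊔ v) (m≤m⊔n u v)))
                         (psi-mono (3 + i) (π₂ p) g (m≤n⊔m u v)))
      (λ (_ , g) → u , trans (later u ≤-refl) g)
      where
      later : ∀ v → u ≤ v → psi v (3 + i) (π₂ p) x ≡ frozenTab z x
      later v u≤v rewrite freeze-mono {u} {v} {i} {π₂ p} e u≤v = refl

  same-value : ∀ {b b′ m m′} → Pair b m ≐ Pair b′ m′ → m ≡ m′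
  same-value {b} {b′} {m} {m′} e with v , p ← to (e ⟪ 0 , 2 ⟫ m) (0 , pairTab-always 0 b m 0) =
    suc-injective (trans (sym p) (pairTab-always v b′ m′ 0))

  graph-odd : ∀ {p u z} → frozen p u ≡ suc z → Odd (Graph p)
  graph-odd {p} {u} {z} e = Odd-resp (≐-sym (graph-table {p} {u} e)) (frozenTab-odd z)

  -- Domains of odd finite size occur neither among the pairs nor among the candidates that are
  -- never frozen.
  table-unique : ∀ {p q u z} → frozen p u ≡ suc z → Graph p ≐ Graph q → ∃[ v ] ∃[ z′ ] frozen q v ≡ suc z′
  table-unique {p} {q} {u} f e with kind q
  ... | table z′ v f′ = v , z′ , f′
  ... | pair b m b<2 refl =
    contradiction (Odd-resp (≐-trans e (graph-pair b<2)) (graph-odd {p} {u} f)) (pair-¬odd b m)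
  ... | alive i s refl al =
    contradiction (Odd-resp (≐-trans e (graph-alive al)) (graph-odd {p} {u} f)) (even-¬odd i)

  alive-≄-pair : ∀ {i s b m} → Alive i s → b < 2 → ¬ (Even i ≐ Pair b m)
  alive-≄-pair {s = s} (_ , none) b<2 e with t , s<t , ev ← pair⇒events b<2 e s = none t s<t ev

  -- Equality with a smaller index would give the larger index events without end, and so no live
  -- candidate.
  alive-index : ∀ {i j s t} → Alive i s → Alive j t → Even i ≐ Even j → i ≡ j
  alive-index {i} {j} {s} {t} (_ , none) (_ , none′) e with <-cmp i j
  ... | tri≈ _ eq _ = eq
  ... | tri< i<j _ _ with r , t<r , ev ← even⇒events i<j (≐-sym e) t = contradiction ev (none′ r t<r)
  ... | tri> _ _ j<i with r , s<r , ev ← even⇒events j<i e s = contradiction ev (none r s<r)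

  alive-stage : ∀ {i s t} → Alive i s → Alive i t → s ≡ t
  alive-stage {i} {s} {t} (ev , none) (ev′ , none′) with <-cmp s t
  ... | tri≈ _ eq _ = eq
  ... | tri< s<t _ _ = contradiction ev′ (none t s<t)
  ... | tri> _ _ t<s = contradiction ev (none′ s t<s)

  alive-unique : ∀ {i s q} → Alive i s → Graph ⟪ 3 + i , s ⟫ ≐ Graph q → q ≡ ⟪ 3 + i , s ⟫
  alive-unique {i} {s} {q} al e with kind q
  ... | table z u f =
    contradiction (Odd-resp (≐-trans (≐-sym e) (graph-alive al)) (graph-odd {q} {u} f)) (even-¬odd i)
  ... | pair b m b<2 refl =
    contradiction (≐-trans (≐-sym (graph-alive al)) (≐-trans e (graph-pair b<2))) (alive-≄-pair al b<2)
  ... | alive j t refl al′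
    with refl ← alive-index al al′ (≐-trans (≐-sym (graph-alive al)) (≐-trans e (graph-alive al′)))
    with refl ← alive-stage al al′ = refl

  pair-unique : ∀ {b m q} → b < 2 → Graph ⟪ b , m ⟫ ≐ Graph q → ∃[ b′ ] b′ < 2 × q ≡ ⟪ b′ , m ⟫
  pair-unique {b} {m} {q} b<2 e with kind q
  ... | table z u f =
    contradiction (Odd-resp (≐-trans (≐-sym e) (graph-pair b<2)) (graph-odd {q} {u} f)) (pair-¬odd b m)
  ... | alive i s refl al =
    contradiction (≐-trans (≐-sym (graph-alive al)) (≐-trans (≐-sym e) (graph-pair b<2))) (alive-≄-pair al b<2)
  ... | pair b′ m′ b′<2 refl
    with refl ← same-value {b} {b′} (≐-trans (≐-sym (graph-pair b<2)) (≐-trans e (graph-pair b′<2))) =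
    b′ , b′<2 , refl

  -- Every partial computable function has a program

  even-covered : ∀ i → ∃[ p ] Graph p ≐ Even i
  even-covered i with j , e , first ← least (λ j → Even j ≐ Even i) (i , ≐-refl)
                 with em {∃[ b ] ∃[ m ] b < 2 × (Even j ≐ Pair b m)}
  ... | yes (b , m , b<2 , e′) = ⟪ b , m ⟫ , ≐-trans (graph-pair b<2) (≐-trans (≐-sym e′) e)
  ... | no unpaired = candidate (few-events (few-clashes j
            (λ k k<j e′ → first k k<j (≐-trans (≐-sym e′) e))
            (λ b m b<2 e′ → unpaired (b , m , b<2 , e′))))
    where
    candidate : ∃[ B ] (∀ t → Event j t → t < B) → ∃[ p ] Graph p ≐ Even i
    -- Stage 0 is an event by decree, so that a last event exists even without clashes.
    candidate (B , below) with s , al ← last (Event j) (inj₁ refl) B below =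
      ⟪ 3 + j , s ⟫ , ≐-trans (graph-alive al) e

  -- Each new point flips the parity. If the size is odd from some stage on, the table has therefore
  -- stopped growing and is a frozen one; otherwise even stages recur and `evenTab` catches up with
  -- every value.
  tab-covered : ∀ i → ∃[ p ] Graph p ≐ Limit (λ s → tab s i)
  tab-covered i with em {∃[ s₀ ] (∀ s → s₀ ≤ s → size s i ≡ 1)}
  ... | yes (s₀ , odd) = ⟪ 2 , ⟪ i , s₀ ⟫ ⟫ , ≐-trans (graph-⟪⟫ 2 ⟪ i , s₀ ⟫) λ x y → mk⇔
          (λ (_ , e) → s₀ , trans (sym (frozenTab-now i s₀ (odd s₀ ≤-refl) x)) e)
          (λ (s , e) → 0 , trans (frozenTab-now i s₀ (odd s₀ ≤-refl) x) (tab-frozen odd {s} e))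
  ... | no ¬odd with p , e ← even-covered i = p , ≐-trans e λ x y → mk⇔
          (λ (s , g) → s , evenTab-sub s g) (λ (s , g) → catch-up s g (em {∃[ r ] s ≤ r × size r i ≡ 0}))
    where
    catch-up : ∀ s {x y} → tab s i x ≡ suc y → Dec (∃[ r ] s ≤ r × size r i ≡ 0) → Even i x y
    catch-up s {x} g (yes (r , s≤r , even)) = r , trans (evenTab-now r even x) (tab-mono i g s≤r)
    catch-up s g (no none) = contradiction (s , λ r s≤r →
      [ (λ even → contradiction (r , s≤r , even) none) , (λ odd → odd) ]′ (parity-bit (tab r i) r)) ¬odd

-- Unbounded search

least-nonzero : ∀ g {w y} → g w ≡ suc y → ∃[ t ] ∃[ z ] g t ≡ suc z × (∀ t′ → t′ < t → g t′ ≡ 0)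
least-nonzero g {w} e with z , eq ← first-compl g e (≤-refl {suc w})
  with t , _ , h ← first-sound g {suc w} eq = t , z , h

-- The function `μ` is obtained by a bounded search below the given witness. Taking the least zero
-- makes it independent of that witness, hence equal to what `mu` computes even if the witness comes
-- from excluded middle.
minimise : (f : Vec ℕ (suc n) → ℕ) → Comp f → (∀ xs → ∃[ w ] f (w ∷ xs) ≡ 0) →
           Σ (Vec ℕ n → ℕ) λ μ → Comp μ × (∀ xs → f (μ xs ∷ xs) ≡ 0)
minimise f (c computedBy h) ex = μ , (mu c computedBy λ xs → ⇓-mu (below xs) (zero⇓ xs)) , μ-zero
  where
  search : ∀ xs → ∃[ t ] ∃[ z ] 1 ∸ f (t ∷ xs) ≡ suc z × (∀ t′ → t′ < t → 1 ∸ f (t′ ∷ xs) ≡ 0)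
  search xs with w , e ← ex xs = least-nonzero (λ w → 1 ∸ f (w ∷ xs)) {w} (cong (1 ∸_) e)
  μ = λ xs → proj₁ (search xs)
  μ-zero : ∀ xs → f (μ xs ∷ xs) ≡ 0
  μ-zero xs with f (μ xs ∷ xs) | proj₁ (proj₂ (proj₂ (search xs)))
  ... | 0     | _ = refl
  ... | suc k | e = contradiction (trans (sym (0∸n≡0 k)) e) 0≢1+n
  zero⇓ : ∀ xs → c [ μ xs ∷ xs ]⇓ 0
  zero⇓ xs = subst (c [ μ xs ∷ xs ]⇓_) (μ-zero xs) (h _)
  below : ∀ xs z → z < μ xs → ∃[ k ] c [ z ∷ xs ]⇓ suc k
  below xs z z<μ with f (z ∷ xs) | h (z ∷ xs) | proj₂ (proj₂ (proj₂ (search xs))) z z<μ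
  ... | suc k | d | _ = k , d

-- By monotonicity the value at the first stage that shows one is final, so searching for that stage
-- computes the limit.
limit-code : (f : Vec ℕ (suc n) → ℕ) → Comp f →
             (∀ {xs u v y} → f (u ∷ xs) ≡ suc y → u ≤ v → f (v ∷ xs) ≡ suc y) →
             ∃[ c ] (∀ xs y → (∃[ u ] f (u ∷ xs) ≡ suc y) ⇔ c [ xs ]⇓ y)
limit-code {n} f fᶜ mono with gs , vars ← vars⇓ {n} (λ i → i) =
  find , λ xs y → mk⇔ (complete xs y) (correct xs y)
  where
  undefinedᶜ = ∸ᶜ (constᶜ 1) fᶜ
  valueᶜ     = predᶜ fᶜ
  find = comp (code valueᶜ) (mu (code undefinedᶜ) ∷ gs)
  complete : ∀ xs y → (∃[ u ] f (u ∷ xs) ≡ suc y) → find [ xs ]⇓ y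
  complete xs y (u , e) with t , z , e′ , first ← least-nonzero (λ u → f (u ∷ xs)) {u} e =
    ⇓-comp (⇓-mu (λ z z<t → 0 ,
                        subst (code undefinedᶜ [ z ∷ xs ]⇓_) (cong (1 ∸_) (first z z<t)) (computes undefinedᶜ _))
              (subst (code undefinedᶜ [ t ∷ xs ]⇓_) (trans (cong (1 ∸_) e′) (0∸n≡0 z)) (computes undefinedᶜ _))
            ∷ subst (Pointwise _ gs) (tabulate∘lookup xs) (vars xs))
           (subst (code valueᶜ [ t ∷ xs ]⇓_) (cong pred value) (computes valueᶜ _))
    where
    value : f (t ∷ xs) ≡ suc y
    value = trans e′ (trans (sym (mono e′ (m≤m⊔n t u))) (mono e (m≤n⊔m t u)))
  correct : ∀ xs y → find [ xs ]⇓ y → ∃[ u ] f (u ∷ xs) ≡ suc y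
  correct xs y d@(⇓-comp (⇓-mu {y = u} _ stop ∷ _) _) with f (u ∷ xs) in eq
  ... | 0 = contradiction
    (trans (⇓-deterministic (code undefinedᶜ) stop (computes undefinedᶜ _)) (cong (1 ∸_) eq)) 0≢1+n
  ... | suc z with refl ← ⇓-deterministic find d (complete xs z (u , eq)) = u , eq

Comp₁ : (ℕ → ℕ) → Set
Comp₁ t = Comp {1} (λ xs → t (lookup xs 0F))

comp⇒computable : ∀ t → Comp₁ t → Computable t
comp⇒computable t (c computedBy h) = c , λ { (x ∷ []) y →
  mk⇔ (λ { refl → h (x ∷ []) }) (λ d → ⇓-deterministic c (h (x ∷ [])) d) }

computable⇒comp : ∀ t → Computable t → Comp₁ t
computable⇒comp t (c , e) = c computedBy λ { (x ∷ []) → to (e (x ∷ []) (t x)) refl }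

opaque
  minimiseᵣ : {P : Vec ℕ 2 → Set} → Rec P → (∀ p → ∃[ w ] P (w ∷ p ∷ [])) →
              ∃[ μ ] Comp₁ μ × (∀ p → P (μ p ∷ p ∷ []))
  minimiseᵣ R ex with μ , μᶜ , μ-zero ← minimise (χ R) (χᶜ R)
                       (λ { (p ∷ []) → let w , h = ex p in w , compl R _ h }) =
    (λ p → μ (p ∷ [])) , at₁ μᶜ (varᶜ 0F) , λ p → sound R _ (μ-zero (p ∷ []))

  -- `g` need not be computable: finitely many of its values can be built into the code as
  -- constants.
  patch : ∀ {s} → Comp₁ s → (g : ℕ → ℕ) → ∀ N →
          ∃[ s′ ] Comp₁ s′ × (∀ p → p < N → s′ p ≡ g p) × (∀ p → N ≤ p → s′ p ≡ s p)
  patch {s} sᶜ g 0 = s , sᶜ , (λ _ ()) , λ _ _ → refl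
  patch {s} sᶜ g (suc N) with s′ , s′ᶜ , inside , outside ← patch sᶜ g N =
    s″ , ifzᶜ (at₂ (χᶜ sameᵣ) (varᶜ 0F) (constᶜ N)) (constᶜ (g N)) s′ᶜ ,
    (λ p p<1+N → [ (λ p<N → trans (other p (<⇒≢ p<N)) (inside p p<N)) , (λ { refl → at-N }) ]′
                   (m<1+n⇒m<n∨m≡n p<1+N)) ,
    λ p N<p → trans (other p (λ p≡N → <⇒≢ N<p (sym p≡N))) (outside p (<⇒≤ N<p))
    where
    s″ : ℕ → ℕ
    s″ p = ifz (χ sameᵣ (p ∷ N ∷ [])) (g N) (s′ p)
    at-N : s″ N ≡ g N
    at-N rewrite compl sameᵣ (N ∷ N ∷ []) refl = refl
    other : ∀ p → p ≢ N → s″ p ≡ s′ p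
    other p p≢N with χ sameᵣ (p ∷ N ∷ []) in eq
    ... | 0     = contradiction (sound sameᵣ (p ∷ N ∷ []) eq) p≢N
    ... | suc _ = refl

-- The numbering as a partial computable function, detected equalities

ψ : Vec ℕ 2 ⇀ ℕ
ψ = record
  { graph         = λ xs y → Graph (lookup xs 0F) (lookup xs 1F) y
  ; deterministic = λ {xs} → limit-unique (Ψ (lookup xs 0F)) (Ψ-mono (lookup xs 0F)) }

ψ-computable : PartialComputable ψ
ψ-computable with c , e ← limit-code {2} (λ xs → Ψ (lookup xs 1F) (lookup xs 0F) (lookup xs 2F))
                            (Ψᶜ (varᶜ 1F) (varᶜ 0F) (varᶜ 2F)) (λ { {p ∷ x ∷ []} → Ψ-mono p }) = c , e

section-computable : ∀ p → PartialComputable (ψ ⟨ p ⟩)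
section-computable p with c , e ← ψ-computable | constᶜ {1} p
... | k computedBy h = comp c (k ∷ proj 0F ∷ []) , λ { (x ∷ []) y → mk⇔
  (λ g → ⇓-comp (h _ ∷ ⇓-proj ∷ []) (to (e (p ∷ x ∷ []) y) g))
  (λ { (⇓-comp (d ∷ ⇓-proj ∷ []) d′) → from (e (p ∷ x ∷ []) y)
         (subst (λ p → c [ p ∷ x ∷ [] ]⇓ y) (⇓-deterministic k d (h _)) d′) }) }

≐⇒≗ : ∀ {p q} → Graph p ≐ Graph q → ψ ⟨ p ⟩ ≗ ψ ⟨ q ⟩
≐⇒≗ e xs y = e (lookup xs 0F) y

≗⇒≐ : ∀ {p q} → ψ ⟨ p ⟩ ≗ ψ ⟨ q ⟩ → Graph p ≐ Graph q
≗⇒≐ e x y = e (x ∷ []) y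

frozenᶜ : Comp a → Comp b → Comp (λ xs → frozen (a xs) (b xs))
frozenᶜ aᶜ bᶜ = frozenAtᶜ bᶜ (π₁ᶜ aᶜ) (π₂ᶜ aᶜ)

frozen-mono : ∀ {p u v z} → frozen p u ≡ suc z → u ≤ v → frozen p v ≡ suc z
frozen-mono {p} {u} {v} {z} = go (π₁ p)
  where
  go : ∀ t → frozenAt u t (π₂ p) ≡ suc z → u ≤ v → frozenAt v t (π₂ p) ≡ suc z
  go 2                   e _   = e
  go (suc (suc (suc i))) e u≤v = freeze-mono {u} {v} {i} e u≤v

-- The equalities of programs detected by stage u.  Those of the last kind are
-- correct for all but finitely many pairs.

Linked : ℕ → ℕ → ℕ → ℕ → Set
Linked f u p q =
    p ≡ q
  ⊎ (1 ≤ frozen p u × 1 ≤ frozen q u ×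
      (∀ x → x < frozen p u + frozen q u →
        frozenTab (pred (frozen p u)) x ≡ frozenTab (pred (frozen q u)) x))
  ⊎ (π₁ p < 2 × π₁ q < 2 × π₂ p ≡ π₂ q × π₁ (π₂ p) ≤ f)

opaque
  linkedᵣ : Comp a → Comp b → Comp c → Comp d → Rec (λ xs → Linked (a xs) (b xs) (c xs) (d xs))
  linkedᵣ {a = a} {b = b} {c = c} {d = d} aᶜ bᶜ cᶜ dᶜ = record
    { χ = _ ; χᶜ = at₄ (χᶜ R) aᶜ bᶜ cᶜ dᶜ
    ; sound = λ xs → sound R (a xs ∷ b xs ∷ c xs ∷ d xs ∷ [])
    ; compl = λ xs → compl R (a xs ∷ b xs ∷ c xs ∷ d xs ∷ []) }
    where
    R : Rec {4} (λ xs → Linked (lookup xs 0F) (lookup xs 1F) (lookup xs 2F) (lookup xs 3F))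
    R = ≡ᵣ (varᶜ 2F) (varᶜ 3F)
      ∨ᵣ (≤ᵣ (constᶜ 1) (frozenᶜ (varᶜ 2F) (varᶜ 1F)) ∧ᵣ ≤ᵣ (constᶜ 1) (frozenᶜ (varᶜ 3F) (varᶜ 1F))
          ∧ᵣ ∀<ᵣ (+ᶜ (frozenᶜ (varᶜ 2F) (varᶜ 1F)) (frozenᶜ (varᶜ 3F) (varᶜ 1F)))
               (≡ᵣ (frozenTabᶜ (predᶜ (frozenᶜ (varᶜ 3F) (varᶜ 2F))) (varᶜ 0F))
                  (frozenTabᶜ (predᶜ (frozenᶜ (varᶜ 4F) (varᶜ 2F))) (varᶜ 0F))))
      ∨ᵣ (<ᵣ (π₁ᶜ (varᶜ 2F)) (constᶜ 2) ∧ᵣ <ᵣ (π₁ᶜ (varᶜ 3F)) (constᶜ 2)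
          ∧ᵣ ≡ᵣ (π₂ᶜ (varᶜ 2F)) (π₂ᶜ (varᶜ 3F)) ∧ᵣ ≤ᵣ (π₁ᶜ (π₂ᶜ (varᶜ 2F))) (varᶜ 0F))

Reaches : ℕ → ℕ → Set
Reaches f m = ∃[ u ] Reach u f m

Selected : ℕ → Set
Selected m = ∃[ u ] selected u (π₁ m) ≡ suc (π₂ m)

Reaches-down : ∀ {f m m′} → m ≤ m′ → Reaches f m′ → Reaches f m
Reaches-down m≤m′ (u , r) = u , λ k k<m → r k (<-≤-trans k<m m≤m′)

Reaches-exempt : ∀ {f m} → π₁ m ≤ f → Reaches f m → Reaches f (suc m)
Reaches-exempt le (u , r) = u , λ k k<1+m → [ r k , (λ { refl → inj₁ le }) ]′ (m<1+n⇒m<n∨m≡n k<1+m)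

Reaches-hit : ∀ {f m u v} → Reaches f m → Hit u f ⟪ 0 , m ⟫ → Hit v f ⟪ 1 , m ⟫ → Reaches f (suc m)
Reaches-hit {u = u} {v} (w , r) h h′ = u ⊔ v ⊔ w , λ k k<1+m →
  [ Reach-mono (m≤n⊔m (u ⊔ v) w) r k
  , (λ { refl → inj₂ ( Hit-mono (≤-trans (m≤m⊔n u v) (m≤m⊔n (u ⊔ v) w)) h
                     , Hit-mono (≤-trans (m≤n⊔m u v) (m≤m⊔n (u ⊔ v) w)) h′) }) ]′ (m<1+n⇒m<n∨m≡n k<1+m)

-- Minimality

module Minimality (em : ExcludedMiddle 0ℓ) where
  open Classical em

  Split : ℕ → Set
  Split m = ¬ (Pair 0 m ≐ Pair 1 m)

  Stuck : ℕ → ℕ → Set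
  Stuck f m = Reaches f m × ¬ Reaches f (suc m)

  -- At `⟪ f , 0 ⟫` program `b` waits for `f` to reach `b + m`; if reaching `m` always entails
  -- reaching `suc m`, the two domains coincide there.
  unsplit : ∀ {m} → (∀ f → Reaches f m → Reaches f (suc m)) → ¬ Selected m → Pair 0 m ≐ Pair 1 m
  unsplit {m} advance unselected x y = mk⇔ forth back
    where
    forth : Pair 0 m x y → Pair 1 m x y
    forth (u , e) with pairTab-suc {u} {0} {m} {x} e
    ... | inj₂ (inj₁ (_ , _ , s)) , _ = contradiction (u , s) unselected
    ... | inj₂ (inj₂ le) , refl = u , pairTab-yes {u} {1} (inj₂ (inj₂ le))
    ... | inj₁ (eq , r) , refl with v , r′ ← advance _ (u , r) = v , pairTab-yes {v} {1} (inj₁ (eq , r′))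
    back : Pair 1 m x y → Pair 0 m x y
    back (u , e) with pairTab-suc {u} {1} {m} {x} e
    ... | inj₂ (inj₂ le) , refl = u , pairTab-yes {u} {0} (inj₂ (inj₂ le))
    ... | inj₁ (eq , r) , refl = u , pairTab-yes {u} {0} (inj₁ (eq , λ k k<m → r k (m<n⇒m<1+n k<m)))

  split-cause : ∀ {m} → Split m → (∃[ f ] Stuck f m) ⊎ Selected m
  split-cause {m} split with em {∃[ f ] Stuck f m} | em {Selected m}
  ... | yes stuck | _      = inj₁ stuck
  ... | no _      | yes s  = inj₂ s
  ... | no ¬stuck | no ¬s  = contradiction (unsplit advance ¬s) split
    where
    advance : ∀ f → Reaches f m → Reaches f (suc m)
    advance f r with em {Reaches f (suc m)}
    ... | yes r′ = r′
    ... | no ¬r′ = contradiction (f , r , ¬r′) ¬stuck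

  stuck-unique : ∀ {f m m′} → Stuck f m → Stuck f m′ → m ≡ m′
  stuck-unique {f} {m} {m′} (r , ¬r) (r′ , ¬r′) with <-cmp m m′
  ... | tri≈ _ eq _ = eq
  ... | tri< lt _ _ = contradiction (Reaches-down lt r′) ¬r
  ... | tri> _ _ gt = contradiction (Reaches-down gt r) ¬r′

  selected-unique : ∀ {m m′} → π₁ m ≡ π₁ m′ → Selected m → Selected m′ → m ≡ m′
  selected-unique {m} {m′} eq (u , s) (v , s′) = trans (⟪⟫-unique eq π₂≡) (⟪π₁,π₂⟫ m′)
    where
    mono = first-mono (accepts (π₁ m′))
    s″ : selected u (π₁ m′) ≡ suc (π₂ m)
    s″ = subst (λ e → selected u e ≡ suc (π₂ m)) eq s
    π₂≡ : π₂ m ≡ π₂ m′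
    π₂≡ = suc-injective (trans (sym (mono {u} s″ (m≤m⊔n u v))) (mono {v} s′ (m≤n⊔m u v)))

  split-bounded : ∀ F → ∃[ B ] (∀ m → π₁ m ≤ F → Split m → m < B)
  split-bounded F = proj₁ stucks ⊔ proj₁ selects , bound
    where
    stucks : ∃[ B ] (∀ f m → f < F → Stuck f m → m < B)
    stucks = bounded Stuck F λ f _ → bounded-unique (Stuck f) stuck-unique
    selects : ∃[ B ] (∀ e m → e < suc F → π₁ m ≡ e × Selected m → m < B)
    selects = bounded (λ e m → π₁ m ≡ e × Selected m) (suc F) λ e _ →
      bounded-unique _ λ (eq , s) (eq′ , s′) → selected-unique (trans eq (sym eq′)) s s′
    bound : ∀ m → π₁ m ≤ F → Split m → m < proj₁ stucks ⊔ proj₁ selects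
    bound m le split with split-cause split
    ... | inj₂ s = <-≤-trans (proj₂ selects (π₁ m) m (s≤s le) (refl , s)) (m≤n⊔m (proj₁ stucks) _)
    ... | inj₁ (f , r , ¬r) with <-≤-connex f F
    ...   | inj₁ f<F = <-≤-trans (proj₂ stucks f m f<F (r , ¬r)) (m≤m⊔n (proj₁ stucks) _)
    -- Such an `f` is exempt from pair `m` and cannot be stuck at it.
    ...   | inj₂ F≤f = contradiction (Reaches-exempt (≤-trans le F≤f) r) ¬r

  unsplit-equal : ∀ {b b′ m} → b < 2 → b′ < 2 → ¬ Split m → Graph ⟪ b , m ⟫ ≐ Graph ⟪ b′ , m ⟫
  unsplit-equal {b} {b′} {m} b<2 b′<2 ¬split with em {Pair 0 m ≐ Pair 1 m}
  ... | no split = contradiction split ¬split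
  ... | yes same =
    ≐-trans (graph-pair b<2) (≐-trans (to-0 b<2) (≐-trans (≐-sym (to-0 b′<2)) (≐-sym (graph-pair b′<2))))
    where
    to-0 : ∀ {b} → b < 2 → Pair b m ≐ Pair 0 m
    to-0 {0}           _ = ≐-refl
    to-0 {1}           _ = ≐-sym same
    to-0 {suc (suc _)} (s<s (s<s ()))

  module Translation (t : ℕ → ℕ) (f : ℕ)
                     (enumerates : ∀ n → ∃[ u ] tab u f n ≡ suc (t n))
                     (onto : ∀ p → ∃[ n ] Graph p ≐ Graph (t n)) where

    hit : ∀ {n q} → t n ≡ q → ∃[ u ] Hit u f q
    hit {n} refl with u , e ← enumerates n = u , n , tab-bound {u} {f} e , e

    -- Some image is equal to `⟪ b , m ⟫`, hence is a program of the same pair, and splitting rules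
    -- out the other one.
    split-hit : ∀ {b m} → b < 2 → Split m → ∃[ n ] t n ≡ ⟪ b , m ⟫
    split-hit {b} {m} b<2 split with n , e ← onto ⟪ b , m ⟫ with b′ , b′<2 , eq ← pair-unique b<2 e =
      n , trans eq (cong ⟪_, m ⟫ (same b b′ b<2 b′<2
        (≐-trans (≐-sym (graph-pair b<2)) (≐-trans e
          (subst (λ q → Graph q ≐ Pair b′ m) (sym eq) (graph-pair b′<2))))))
      where
      same : ∀ b b′ → b < 2 → b′ < 2 → Pair b m ≐ Pair b′ m → b′ ≡ b
      same 0 0 _ _ _ = refl
      same 1 1 _ _ _ = refl
      same 0 1 _ _ e = contradiction e split
      same 1 0 _ _ e = contradiction (≐-sym e) split
      same (suc (suc _)) _ (s<s (s<s ())) _ _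
      same _ (suc (suc _)) _ (s<s (s<s ())) _

    -- If f were stuck at m, then the programs of m would differ at ⟪ f , 0 ⟫, and
    -- t would have to hit both of them.

    reaches : ∀ m → Reaches f m
    reaches 0 = 0 , λ _ ()
    reaches (suc m) with em {Reaches f (suc m)}
    ... | yes r = r
    ... | no ¬r with u , r ← reaches m =
      Reaches-hit (u , r) (proj₂ (hit (proj₂ (split-hit z<s split))))
        (proj₂ (hit (proj₂ (split-hit (s<s z<s) split))))
      where
      split : Split m
      split e with v , e′ ← to (e ⟪ f , 0 ⟫ m) (u , pairTab-yes {u} {0}
                      (inj₁ (π₂-⟪⟫ f 0 , subst (λ f → Reach u f m) (sym (π₁-⟪⟫ f 0)) r)))
              with pairTab-suc {v} {1} {m} e′
      ... | inj₁ (_ , r′) , _ = ¬r (v , subst (λ f → Reach v f (suc m)) (π₁-⟪⟫ f 0) r′)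
      ... | inj₂ (inj₂ le) , _ = contradiction (≤-trans le (≤-reflexive (π₂-⟪⟫ f 0))) λ ()

    pressed : ∀ {b m} → b < 2 → f < π₁ m → ∃[ n ] t n ≡ ⟪ b , m ⟫
    pressed {b} {m} b<2 f<e with u , r ← reaches (suc m) with r m ≤-refl
    ... | inj₁ le = contradiction le (<⇒≱ f<e)
    ... | inj₂ hits = preimage (both b b<2)
      where
      both : ∀ b → b < 2 → Hit u f ⟪ b , m ⟫
      both 0 _ = proj₁ hits
      both 1 _ = proj₂ hits
      both (suc (suc _)) (s<s (s<s ()))
      preimage : Hit u f ⟪ b , m ⟫ → ∃[ n ] t n ≡ ⟪ b , m ⟫
      preimage (n , _ , e) with v , e′ ← enumerates n =
        n , limit-unique (λ u → tab u f) (tab-mono f) (v , e′) (u , e)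

    -- Live candidates and the programs of pairs beyond `f` are themselves images. A frozen program
    -- has an image that will be found frozen as well, with the same table. For the remaining pairs
    -- any equal image lies in the same pair.
    linked : ∀ p → ∃[ n ] ∃[ u ] Linked f u p (t n)
    linked p with kind p
    ... | alive i s refl al with n , e ← onto p = n , 0 , inj₁ (sym (alive-unique al e))
    ... | table z u fz with n , e ← onto p with v , z′ , fz′ ← table-unique {p} {t n} {u} fz e =
      n , u ⊔ v , inj₂ (inj₁ (link (frozen-mono {p} fz (m≤m⊔n u v)) (frozen-mono {t n} fz′ (m≤n⊔m u v))))
      where
      same : ∀ x → frozenTab z x ≡ frozenTab z′ x
      same x with e′ ← ≐-trans (≐-sym (graph-table {p} {u} fz)) (≐-trans e (graph-table {t n} {v} fz′)) =
        suc-≡ λ y → mk⇔ (λ g → proj₂ (to (e′ x y) (0 , g))) (λ g → proj₂ (from (e′ x y) (0 , g)))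
      link : ∀ {k l} → k ≡ suc z → l ≡ suc z′ →
             1 ≤ k × 1 ≤ l × (∀ x → x < k + l → frozenTab (pred k) x ≡ frozenTab (pred l) x)
      link refl refl = s≤s z≤n , s≤s z≤n , λ x _ → same x
    ... | pair b m b<2 refl with <-≤-connex f (π₁ m)
    ...   | inj₁ f<e with n , eq ← pressed b<2 f<e = n , 0 , inj₁ (sym eq)
    ...   | inj₂ e≤f with n , e ← onto p with b′ , b′<2 , eq ← pair-unique b<2 e =
      n , 0 , inj₂ (inj₂ ( subst (_< 2) (sym (π₁-⟪⟫ b m)) b<2
                         , subst (_< 2) (sym (trans (cong π₁ eq) (π₁-⟪⟫ b′ m))) b′<2
                         , trans (π₂-⟪⟫ b m) (sym (trans (cong π₂ eq) (π₂-⟪⟫ b′ m)))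
                         , subst (λ m → π₁ m ≤ f) (sym (π₂-⟪⟫ b m)) e≤f ))

  -- By monotonicity of pairing, a program of a pair whose number exceeds `⟪ 2 , B ⟫` belongs to a
  -- pair beyond `B`, where declared equalities are true.
  linked-sound : ∀ {f B} → (∀ m → π₁ m ≤ f → Split m → m < B) →
                 ∀ {u p q} → ⟪ 2 , B ⟫ < p → Linked f u p q → Graph p ≐ Graph q
  linked-sound few big (inj₁ refl) = ≐-refl
  linked-sound few {u} {p} {q} big (inj₂ (inj₁ (p≥1 , q≥1 , same)))
    with frozen p u in eq | frozen q u in eq′
  ... | suc z | suc z′ = ≐-trans (graph-table {p} {u} eq) (≐-trans tables (≐-sym (graph-table {q} {u} eq′)))
    where
    -- A frozen table is empty beyond its own number, so comparing up to the sum of the shifted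
    -- numbers decides equality.
    beyond : ∀ z {x} → z < x → frozenTab z x ≡ 0
    beyond z z<x = frozenTab-beyond z _ (≤-<-trans (π₂-≤ z) z<x)
    all : ∀ x → frozenTab z x ≡ frozenTab z′ x
    all x with <-≤-connex x (suc z + suc z′)
    ... | inj₁ lt = same x lt
    ... | inj₂ ge = trans (beyond z (≤-trans (m≤m+n (suc z) _) ge))
                      (sym (beyond z′ (≤-trans (m≤n+m (suc z′) (suc z)) ge)))
    tables : Table z ≐ Table z′
    tables x y = mk⇔ (λ (u , e) → u , trans (sym (all x)) e) (λ (u , e) → u , trans (all x) e)
  linked-sound {f} {B} few {u} {p} {q} big (inj₂ (inj₂ (p<2 , q<2 , eq , le))) =
    subst₂ (λ p q → Graph p ≐ Graph q) (⟪π₁,π₂⟫ p) (trans (cong ⟪ π₁ q ,_⟫ eq) (⟪π₁,π₂⟫ q))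
      (unsplit-equal p<2 q<2 λ split → <-irrefl refl (<-≤-trans big
        (subst (_≤ ⟪ 2 , B ⟫) (⟪π₁,π₂⟫ p) (⟪⟫-mono (<⇒≤ p<2) (<⇒≤ (few (π₂ p) le split))))))

  index-enumerates : (c : Code 1) → ∀ x y → c [ x ∷ [] ]⇓ y ⇔ Limit (λ s → tab s (index c)) x y
  index-enumerates c x y = mk⇔
    (λ d → tab-complete (proj₂ (U-complete c d)))
    (λ (s , e) → U-sound c (proj₂ (tab-sound {s} e)))

  ψ-isEps : IsEps ψ
  ψ-isEps = record { partialComputable = ψ-computable ; universal = universal }
    where
    universal : ∀ ζ → PartialComputable ζ → ∃[ p ] ψ ⟨ p ⟩ ≗ ζ
    universal ζ (c , e) with p , g ← tab-covered (index c) = p , λ { (x ∷ []) y →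
      mk⇔ (λ d → from (e _ y) (from (index-enumerates c x y) (to (g x y) d)))
          (λ d → from (g x y) (to (index-enumerates c x y) (to (e _ y) d))) }

  module Inverse (t : ℕ → ℕ) (tᶜ : Comp₁ t) (f P₀ : ℕ)
                 (onto : ∀ p → ∃[ n ] Graph p ≐ Graph (t n))
                 (linked : ∀ p → ∃[ n ] ∃[ u ] Linked f u p (t n))
                 (correct : ∀ {u p q} → P₀ ≤ p → Linked f u p q → Graph p ≐ Graph q) where

    Target : Vec ℕ 2 → Set
    Target xs = Linked f (π₂ (lookup xs 0F)) (lookup xs 1F) (t (π₁ (lookup xs 0F)))

    targetᵣ : Rec Target
    targetᵣ = linkedᵣ (constᶜ f) (π₂ᶜ (varᶜ 0F)) (varᶜ 1F) (at₁ tᶜ (π₁ᶜ (varᶜ 0F)))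

    found : ∀ p → ∃[ w ] Target (w ∷ p ∷ [])
    found p with n , u , l ← linked p = ⟪ n , u ⟫ ,
      subst₂ (λ n u → Linked f u p (t n)) (sym (π₁-⟪⟫ n u)) (sym (π₂-⟪⟫ n u)) l

    -- The search may return a wrong image below `P₀`; there the values are replaced by preimages
    -- known from `onto`.
    inverse : ∃[ s ] Comp₁ s × (∀ p → Graph p ≐ Graph (t (s p)))
    inverse with μ , μᶜ , targets ← minimiseᵣ targetᵣ found
      with s , sᶜ , small , large ← patch {λ p → π₁ (μ p)} (π₁ᶜ μᶜ) (λ p → proj₁ (onto p)) P₀ =
      s , sᶜ , λ p → [ (λ p<P₀ → subst (λ n → Graph p ≐ Graph (t n)) (sym (small p p<P₀)) (proj₂ (onto p)))
                     , (λ P₀≤p → subst (λ n → Graph p ≐ Graph (t n)) (sym (large p P₀≤p))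
                                   (correct {π₂ (μ p)} P₀≤p (targets p))) ]′ (<-≤-connex p P₀)

  ψ-minimal : Minimal ψ
  ψ-minimal θ θ-eps (t , t-wit) = s , record
    { computable = comp⇒computable s sᶜ
    ; translates = λ p xs y → mk⇔
        (λ g → from (translates (s p) xs y) (to (≐⇒≗ (s-correct p) xs y) g))
        (λ g → from (≐⇒≗ (s-correct p) xs y) (to (translates (s p) xs y) g)) }
    where
    open Witnesses t-wit using (translates)
    tᶜ : Comp₁ t
    tᶜ = computable⇒comp t (Witnesses.computable t-wit)
    f : ℕ
    f = index (code tᶜ)
    onto : ∀ p → ∃[ n ] Graph p ≐ Graph (t n)
    onto p with n , e ← IsEps.universal θ-eps (ψ ⟨ p ⟩) (section-computable p) = n , λ x y →
      mk⇔ (λ g → to (translates n (x ∷ []) y) (from (e (x ∷ []) y) g))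
          (λ g → to (e (x ∷ []) y) (from (translates n (x ∷ []) y) g))
    few = split-bounded f
    inverse : ∃[ s ] Comp₁ s × (∀ p → Graph p ≐ Graph (t (s p)))
    inverse = Inverse.inverse t tᶜ f (suc ⟪ 2 , proj₁ few ⟫) onto
      (Translation.linked t f (λ n → to (index-enumerates (code tᶜ) n (t n)) (computes tᶜ (n ∷ []))) onto)
      (linked-sound (proj₂ few))
    s = proj₁ inverse
    sᶜ = proj₁ (proj₂ inverse)
    s-correct = proj₂ (proj₂ inverse)

  -- Translation functions that a given ceer does not weakly tie

  translation-into-ψ : ∀ t → Comp₁ t → (∀ p → Graph p ≐ Graph (t p)) → IsTranslationInto t ψ
  translation-into-ψ t tᶜ e =
    ψ , ψ-isEps , record { computable = comp⇒computable t tᶜ ; translates = λ p → ≐⇒≗ (e p) }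

  any-bound : ∀ ys → ∃[ K ] (∀ {P : ℕ → Set} → Any P ys → ∃[ y ] P y × y < K)
  any-bound [] = 0 , λ ()
  any-bound (y ∷ ys) with K , h ← any-bound ys = suc y ⊔ K , λ
    { (here p)  → y , p , m≤m⊔n (suc y) K
    ; (there a) → let y′ , p , lt = h a in y′ , p , <-≤-trans lt (m≤n⊔m (suc y) K) }

  module Untied (R : Rel ℕ 0ℓ) (R-ceer : IsCeer R) where
    open IsCeer R-ceer using (isEquivalence; computablyEnumerable)

    acceptor : Code 2
    acceptor = proj₁ (proj₁ (proj₂ computablyEnumerable))

    R⇔acceptor : ∀ p q → R p q ⇔ (∃[ y ] acceptor [ p ∷ q ∷ [] ]⇓ y)
    R⇔acceptor p q with φ , (_ , e) , h ← computablyEnumerable = mk⇔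
      (λ r → let y , g = to (h p q) r in y , to (e _ y) g)
      (λ (y , d) → from (h p q) (y , from (e _ y) d))

    e : ℕ
    e = index acceptor

    Enumerated : ℕ → Set
    Enumerated k = R ⟪ 0 , ⟪ e , k ⟫ ⟫ ⟪ 1 , ⟪ e , k ⟫ ⟫

    accepted : ∀ {k} → Enumerated k → ∃[ w ] ∃[ z ] accepts e w ≡ suc z
    accepted {k} r with y , d ← to (R⇔acceptor _ _) r
                   with κ , h ← U-complete acceptor d = ⟪ k , κ ⟫ , k , eq
      where
      eq : accepts e ⟪ k , κ ⟫ ≡ suc k
      eq rewrite π₁-⟪⟫ k κ | π₂-⟪⟫ k κ | h = refl

    accepts-sound : ∀ {w z} → accepts e w ≡ suc z → Enumerated z
    accepts-sound {w} a
      with U e ⟪ ⟪ 0 , ⟪ e , π₁ w ⟫ ⟫ , ⟪ ⟪ 1 , ⟪ e , π₁ w ⟫ ⟫ , 0 ⟫ ⟫ (π₂ w) in eq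
    accepts-sound {w} refl | suc y = from (R⇔acceptor _ _) (y , U-sound acceptor eq)

    -- The selected `z` is the one accepted first and may differ from the given `k`; any related
    -- pair will do.
    selected-enumerated : (∃[ k ] Enumerated k) → ∃[ z ] Enumerated z × Selected ⟪ e , z ⟫
    selected-enumerated (k , r)
      with w , _ , a ← accepted r
      with z , sel ← first-compl (accepts e) a (≤-refl {suc w})
      with _ , _ , a′ , _ ← first-sound (accepts e) {suc w} sel =
      z , accepts-sound a′ ,
      (suc w , trans (cong (selected (suc w)) (π₁-⟪⟫ e z)) (trans sel (cong suc (sym (π₂-⟪⟫ e z)))))

    selected-split : ∀ {m} → Selected m → ¬ (Graph ⟪ 0 , m ⟫ ≐ Graph ⟪ 1 , m ⟫)
    selected-split {m} (u , s) same
      with v , p ← to (≐-trans (≐-sym (graph-pair z<s)) (≐-trans same (graph-pair (s<s z<s))) ⟪ 0 , 1 ⟫ m)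
                     (u , pairTab-yes {u} {0} (inj₂ (inj₁ (π₂-⟪⟫ 0 1 , refl , s))))
      with pairTab-suc {v} {1} {m} p
    ... | inj₁ (eq , _) , _ = contradiction (trans (sym eq) (π₂-⟪⟫ 0 1)) 0≢1+n
    ... | inj₂ (inj₂ le) , _ = contradiction (≤-trans le (≤-reflexive (π₂-⟪⟫ 0 1))) λ { (s≤s ()) }

    -- The condition `within` fails, whatever the translation function, so the identity serves.
    untied-id : (∃[ k ] Enumerated k) → ¬ WeaklyTies R (λ p → p) ψ
    untied-id ex ties with z , r , sel ← selected-enumerated ex =
      selected-split sel (≗⇒≐ (WeaklyTies.within ties r))

    B : ℕ
    B = proj₁ (split-bounded e)

    -- The bound `B` avoids all split pairs with first component `e`, so that merging respects the
    -- functions computed.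
    Merged : ℕ → Set
    Merged p = π₁ p ≡ 1 × π₁ (π₂ p) ≡ e × B ≤ π₂ p

    opaque
      mergedᵣ : Rec {1} (λ xs → Merged (lookup xs 0F))
      mergedᵣ = ≡ᵣ (π₁ᶜ (varᶜ 0F)) (constᶜ 1)
        ∧ᵣ ≡ᵣ (π₁ᶜ (π₂ᶜ (varᶜ 0F))) (constᶜ e)
        ∧ᵣ ≤ᵣ (constᶜ B) (π₂ᶜ (varᶜ 0F))

    merge : ℕ → ℕ
    merge p = ifz (χ mergedᵣ (p ∷ [])) ⟪ 0 , π₂ p ⟫ p

    mergeᶜ : Comp₁ merge
    mergeᶜ = ifzᶜ (at₁ (χᶜ mergedᵣ) (varᶜ 0F)) (⟪⟫ᶜ (constᶜ 0) (π₂ᶜ (varᶜ 0F))) (varᶜ 0F)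

    merge-correct : ∀ p → Graph p ≐ Graph (merge p)
    merge-correct p with χ mergedᵣ (p ∷ []) in eq
    ... | suc _ = ≐-refl
    ... | 0 with π₁≡1 , π₁≡e , B≤ ← sound mergedᵣ (p ∷ []) eq =
      subst (λ q → Graph q ≐ Graph ⟪ 0 , π₂ p ⟫) (sym (⟪⟫-unique π₁≡1 refl))
        (unsplit-equal (s<s z<s) z<s λ split →
          <-irrefl refl (<-≤-trans (proj₂ (split-bounded e) (π₂ p) (≤-reflexive π₁≡e) split) B≤))

    missed : ∀ k → B ≤ k → ∀ n → merge n ≢ ⟪ 1 , ⟪ e , k ⟫ ⟫
    missed k B≤k n with χ mergedᵣ (n ∷ []) in eq
    ... | 0     = λ h → 0≢1+n (trans (sym (π₁-⟪⟫ 0 _)) (trans (cong π₁ h) (π₁-⟪⟫ 1 _)))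
    ... | suc _ = λ { refl → contradiction (trans (sym (compl mergedᵣ (n ∷ []) merged)) eq) 0≢1+n }
      where
      m = ⟪ e , k ⟫
      merged : Merged ⟪ 1 , m ⟫
      merged = π₁-⟪⟫ 1 m , trans (cong π₁ (π₂-⟪⟫ 1 m)) (π₁-⟪⟫ e k)
             , ≤-trans B≤k (≤-trans (n≤⟪m,n⟫ e k) (≤-reflexive (sym (π₂-⟪⟫ 1 m))))

    -- The only other program that may compute the same function is the partner in the pair, and `R`
    -- never relates the two.
    alone : (∀ {p q} → R p q → Equiv ψ p q) → (∀ k → ¬ Enumerated k) →
            ∀ {k y} → R ⟪ 1 , ⟪ e , k ⟫ ⟫ y → y ≡ ⟪ 1 , ⟪ e , k ⟫ ⟫
    alone within none {k} r with pair-unique (s<s z<s) (≗⇒≐ (within r))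
    ... | 0 , _ , refl = contradiction (IsEquivalence.sym isEquivalence r) (none k)
    ... | 1 , _ , refl = refl
    ... | suc (suc _) , s<s (s<s ()) , _

    untied-merge : (∀ k → ¬ Enumerated k) → ¬ WeaklyTies R merge ψ
    untied-merge none ties
      with record { within = within ; cofinite = ys , unmet } ← ties
      with K , bound ← any-bound ys
      -- The index `B ⊔ K` makes the program missed by `merge` and at least `K`. Its class is a
      -- singleton, so its representative would have to be the program itself, yet lie below `K`.
      with y , r , y<K ← bound (unmet ⟪ 1 , ⟪ e , B ⊔ K ⟫ ⟫ λ { (_ , (n , refl) , r) →
                                  missed (B ⊔ K) (m≤m⊔n B K) n (alone within none r) })
      = <-irrefl refl (<-≤-trans y<K (≤-trans (≤-trans (m≤n⊔m B K) (≤-trans (n≤⟪m,n⟫ e _) (n≤⟪m,n⟫ 1 _)))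
                                       (≤-reflexive (sym (alone within none r)))))

    untied : ∃[ t ] IsTranslationInto t ψ × ¬ WeaklyTies R t ψ
    untied with em {∃[ k ] Enumerated k}
    ... | yes ex  = (λ p → p) , translation-into-ψ (λ p → p) (varᶜ 0F) (λ _ → ≐-refl) , untied-id ex
    ... | no none = merge , translation-into-ψ merge mergeᶜ merge-correct ,
                    untied-merge λ k r → none (k , r)

theorem7 : ExcludedMiddle 0ℓ →
           ∃[ ψ ] IsEps ψ
                × Minimal ψ
                × (∀ (R : Rel ℕ 0ℓ) → IsCeer R →
                     ∃[ t ] IsTranslationInto t ψ × ¬ WeaklyTies R t ψ)
theorem7 em = ψ , ψ-isEps , ψ-minimal , Untied.untied
  where open Minimality em
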